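{- Let $p$ be a prime number, let $a,m\in\mathbb{Z}_{\geq0}$ with $\gcd(a,p)=1$, and let $\theta\in\mathbb{F}_{p^p}$ satisfy $\theta^p=\theta+1$. Put $\tau_{p}(a):=\sum_{j=1}^{p-1} j\,p^{ja-1}$. Then the following congruence holds in $\mathbb{F}_{p}[\lambda]$: \[ a^{m}b_{m}(a^{ -1}, \lambda) \equiv - \mathrm{Tr}(\theta^{\tau_{p}(a)})\,\mathrm{Tr}\left( \frac{(a\lambda+\theta)^{m}}{\theta^{1+\tau_{p}(a)}} \right) \pmod{p}. \]
   Context: $S(m,j)$ denotes the Stirling number of the second kind, $R(n,j,\lambda):=\sum_{m\ge0}\binom{n}{m}S(m,j)\lambda^{n-m}$ and $b_n(x,\lambda):=\sum_{j\ge0}R(n,j,\lambda)x^j\in\mathbb{Z}[x,\lambda]$ is the weighted Bell polynomial. $a^{ -1}$ denotes the inverse of $a$ modulo $p$, and the left side is the image in $\mathbb{F}_p[\lambda]$. $\mathrm{Tr}:\mathbb{F}_{p^p}\to\mathbb{F}_p$ is the trace map, extended $\mathbb{F}_p[\lambda]$-linearly (coefficientwise in $\lambda$) to $\mathbb{F}_{p^p}[\lambda]\to\mathbb{F}_p[\lambda]$. -}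

module Defs where

open import Data.Nat using (ℕ; zero; suc; _+_; _*_; _∸_; _^_; _≡ᵇ_; _≤ᵇ_; NonZero)
open import Data.Nat.DivMod using (_mod_)
open import Data.Nat.Combinatorics using (_C_)
open import Data.Fin using (Fin; toℕ)
open import Data.Vec using (Vec; []; _∷_; zipWith; map; replicate; tabulate; init; last; toList)
open import Data.List using (foldr)
open import Data.Bool using (if_then_else_)

S : ℕ → ℕ → ℕ
S zero    zero    = 1
S zero    (suc j) = 0
S (suc n) zero    = 0
S (suc n) (suc j) = suc j * S n (suc j) + S n j

sumN : ℕ → (ℕ → ℕ) → ℕ
sumN zero    f = 0
sumN (suc n) f = sumN n f + f n

-- Polynomials in λ with ℕ coefficients, as coefficient functions ℕ → ℕ
-- (coefficient of λ^k at index k).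

PolyN : Set
PolyN = ℕ → ℕ

monomialN : ℕ → ℕ → PolyN
monomialN c e k = if k ≡ᵇ e then c else 0

-- R(n,j,λ) = Σ_{m=0}^{n} C(n,m) S(m,j) λ^{n-m}   (terms m > n vanish)
R : ℕ → ℕ → PolyN
R n j k = sumN (suc n) (λ m → monomialN ((n C m) * S m j) (n ∸ m) k)

-- b_n(x,λ) = Σ_j R(n,j,λ) x^j  (R(n,j,λ) = 0 for j > n), evaluated at x ∈ ℕ
bell : ℕ → ℕ → PolyN
bell n x k = sumN (suc n) (λ j → R n j k * x ^ j)

-- τ_p(a) = Σ_{j=1}^{p-1} j p^{ja-1}   (the j = 0 term is 0)
τ : ℕ → ℕ → ℕ
τ p a = sumN p (λ j → j * p ^ (j * a ∸ 1))

module Field (p : ℕ) .{{_ : NonZero p}} where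

  Fp : Set
  Fp = Fin p

  ι : ℕ → Fp
  ι n = n mod p

  _+ₚ_ : Fp → Fp → Fp
  x +ₚ y = (toℕ x + toℕ y) mod p

  _*ₚ_ : Fp → Fp → Fp
  x *ₚ y = (toℕ x * toℕ y) mod p

  negₚ : Fp → Fp
  negₚ x = (p ∸ toℕ x) mod p

  -- elements of 𝔽_{p^p}: coefficient vectors (c_0,…,c_{p-1}) of
  -- c_0 + c_1 x + … + c_{p-1} x^{p-1} in 𝔽_p[x]/(x^p - x - 1)
  -- (x^p - x - 1 is irreducible over 𝔽_p, so this is the field 𝔽_{p^p}).
  F : Set
  F = Vec Fp p

  addF : F → F → F
  addF = zipWith _+ₚ_

  scalF : Fp → F → F
  scalF c = map (c *ₚ_)

  negF : F → F
  negF = map negₚ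

  zeroF : F
  zeroF = replicate p (ι 0)

  constF : Fp → F
  constF c = tabulate (λ i → if toℕ i ≡ᵇ 0 then c else ι 0)

  oneF : F
  oneF = constF (ι 1)

  -- x^p = 1 + x
  redF : F
  redF = tabulate (λ i → if toℕ i ≤ᵇ 1 then ι 1 else ι 0)

  private
    shift : ∀ {n} → Vec Fp n → Vec Fp n
    shift []       = []
    shift (c ∷ cs) = ι 0 ∷ init (c ∷ cs)

    top : ∀ {n} → Vec Fp n → Fp
    top []       = ι 0
    top (c ∷ cs) = last (c ∷ cs)

  mulX : F → F
  mulX v = addF (shift v) (scalF (top v) redF)

  -- a * b = Σ_i b_i x^i a   (Horner)
  mulF : F → F → F
  mulF a b = foldr (λ bi acc → addF (scalF bi a) (mulX acc)) zeroF (toList b)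

  powF : F → ℕ → F
  powF x zero    = oneF
  powF x (suc n) = mulF x (powF x n)

  sumF : ℕ → (ℕ → F) → F
  sumF zero    f = zeroF
  sumF (suc n) f = addF (sumF n f) (f n)

  -- Tr(y) = y + y^p + … + y^{p^{p-1}}, an element of the prime field 𝔽_p ⊆ 𝔽_{p^p}
  Tr : F → F
  Tr y = sumF p (λ i → powF y (p ^ i))

  PolyF : Set
  PolyF = ℕ → F

  mulPoly : PolyF → PolyF → PolyF
  mulPoly f g k = sumF (suc k) (λ i → mulF (f i) (g (k ∸ i)))

  onePoly : PolyF
  onePoly k = if k ≡ᵇ 0 then oneF else zeroF

  powPoly : PolyF → ℕ → PolyF
  powPoly f zero    = onePoly
  powPoly f (suc n) = mulPoly f (powPoly f n)

  linPoly : ℕ → F → PolyF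
  linPoly a θ zero          = θ
  linPoly a θ (suc zero)    = constF (ι a)
  linPoly a θ (suc (suc k)) = zeroF

{-# OPTIONS --safe #-}
module Submission where

open import Defs
open import Algebra.Bundles using (CommutativeRing)
open import Algebra.Structures using (IsCommutativeRing)
open import Data.Nat.Base as ℕ using (ℕ; zero; suc; NonZero; z≤n; s≤s; _<_; _≤_; _∸_)
import Data.Nat.Properties as ℕ
open import Data.Nat.Combinatorics using (_C_; nCn≡1; nCk+nC[k+1]≡[n+1]C[k+1]; nCk≡nC[n∸k]; k>n⇒nCk≡0)
open import Data.Nat.Coprimality using (prime⇒coprime; coprime-Bézout)
open import Data.Nat.Divisibility using (_∣_; divides; ∣⇒≤)
open import Data.Nat.DivMod using
  (_%_; _mod_; m≡m%n+[m/n]*n; m%n<n; m%n%n≡m%n; n%n≡0; m<n⇒m%n≡m; %-distribˡ-+; %-distribˡ-*)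
open import Data.Nat.GCD using (gcd; module Bézout)
open import Data.Nat.Induction using (<-rec)
open import Data.Nat.Primality using (Prime; euclidsLemma; prime⇒nonZero; prime⇒nonTrivial; ¬prime[0]; ¬prime[1])
open import Data.Nat.Solver using (module +-*-Solver)
open import Data.Fin.Base using (Fin; toℕ; inject₁; fromℕ)
import Data.Fin.Properties as Fin
open import Data.Fin.Permutation using (permutation)
open import Data.List.Base using (foldr)
open import Data.Vec.Base using (Vec; []; _∷_; zipWith; map; replicate; tabulate; init; last; toList; _∷ʳ_)
open import Data.Vec.Properties using
  (zipWith-assoc; zipWith-comm; zipWith-identityˡ; zipWith-identityʳ; zipWith-inverseˡ; zipWith-inverseʳ; init-∷ʳ; last-∷ʳ)
open import Data.Product.Base using (∃; _,_)
open import Data.Sum.Base using (inj₁; inj₂)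
open import Data.Empty using (⊥-elim)
open import Function.Base using (_∘_)
open import Level using (0ℓ)
open import Relation.Nullary.Decidable using (yes; no)
open import Relation.Binary.Definitions using (tri<; tri≈; tri>)
open import Relation.Binary.PropositionalEquality
open import Relation.Binary.PropositionalEquality.Algebra using (isMagma)
open ≡-Reasoning

-- Let α = a in 𝔽_p, T = Tr(θ^τ) and u = θ^(-1-τ). Frobenius acts on θ as the translation
-- θ ↦ θ + 1, so by telescoping of exponents and the norm relation Π_{i<p} (θ + iα) = 1 its
-- a-th iterate ψ satisfies ψ(θ^τ) = θ · θ^τ. Consequently Tr(e_k u) does not depend on k,
-- where e_k = Π_{i<k} (θ - iα), and θⁿ = Σ_k S(n,k) α^(n-k) e_k turns Tr(θⁿ u) into the
-- Bell sum times Tr u. The constant is T · Tr u = Σ_{k<p} Tr(θ(θ+α)⋯(θ+(k-1)α) / θ), whose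
-- terms with k > 0 vanish while Tr(1/θ) = -1. The coefficient of λ^k only contributes
-- the factor binom(m,k) a^k to both sides.

-- The exponent τ makes Hilbert 90 explicit: θ has norm 1 under ψ, so θ = ψ(t)/t has a solution t,
-- and τ is chosen so that the power t = θ^τ is one. Both the norm relation and Tr(1/θ) = -1 come
-- from the polynomial identity y^p - y = Π_{i<p} (y + iα). At y = θ its value is 1 and its
-- derivative is -1, so its logarithmic derivative at θ, which is the sum of the conjugates of 1/θ,
-- equals -1. In the code this identity takes the form of a recurrence for doubly indexed families,
-- which can be instantiated at products, at their derivatives and at traces without a polynomial
-- ring. The argument takes place in a commutative ring of characteristic p with y^(p^p) = y, and
-- every inverse is exhibited: integers strictly between 0 and p are inverted by Bézout, and 1/θ is
-- a product of conjugates of θ.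

-- Binomial coefficients, Stirling numbers and the exponent `τ` over the natural numbers.

toℕ-mod : ∀ {p} .{{_ : NonZero p}} n → toℕ (n mod p) ≡ n % p
toℕ-mod {p} n = Fin.toℕ-fromℕ< (m%n<n n p)

-- In the absorption identity (k+1) C(p,k+1) = p C(p-1,k), p divides the right side but not k+1,
-- which is positive and smaller than p.
prime∣binomial : ∀ {p k} → Prime p → suc k < p → p ∣ p C suc k
prime∣binomial {suc q} {k} pp k<p with euclidsLemma (suc k) (suc q C suc k) pp
  (divides (q C k) (trans (absorb q k) (ℕ.*-comm (suc q) (q C k))))
  where
  absorb : ∀ n k → suc k ℕ.* (suc n C suc k) ≡ suc n ℕ.* (n C k)
  absorb n zero = begin
    1 ℕ.* (suc n C 1)    ≡⟨ ℕ.*-identityˡ _ ⟩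
    suc n C 1            ≡⟨ nCk+nC[k+1]≡[n+1]C[k+1] n 0 ⟨
    (n C 0) ℕ.+ (n C 1)  ≡⟨ lemma n ⟩
    suc n                ≡⟨ ℕ.*-identityʳ (suc n) ⟨
    suc n ℕ.* (n C 0)    ∎
    where
    lemma : ∀ n → (n C 0) ℕ.+ (n C 1) ≡ suc n
    lemma zero = refl
    lemma (suc n) = cong suc (trans (sym (nCk+nC[k+1]≡[n+1]C[k+1] n 0)) (lemma n))
  absorb zero (suc k) = trans (cong (suc (suc k) ℕ.*_) (k>n⇒nCk≡0 {1} {suc (suc k)} (s≤s (s≤s z≤n)))) (ℕ.*-zeroʳ (suc (suc k)))
  absorb (suc n) (suc k) = begin
    suc (suc k) ℕ.* (suc (suc n) C suc (suc k))
      ≡⟨ cong (suc (suc k) ℕ.*_) (nCk+nC[k+1]≡[n+1]C[k+1] (suc n) (suc k)) ⟨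
    suc (suc k) ℕ.* (suc n C suc k ℕ.+ suc n C suc (suc k))
      ≡⟨ solve 3 (λ k x y → (con 1 :+ k) :* (x :+ y) := x :+ k :* x :+ (con 1 :+ k) :* y)
           refl (suc k) (suc n C suc k) (suc n C suc (suc k)) ⟩
    suc n C suc k ℕ.+ suc k ℕ.* (suc n C suc k) ℕ.+ suc (suc k) ℕ.* (suc n C suc (suc k))
      ≡⟨ cong₂ (λ x y → suc n C suc k ℕ.+ x ℕ.+ y) (absorb n k) (absorb n (suc k)) ⟩
    suc n C suc k ℕ.+ suc n ℕ.* (n C k) ℕ.+ suc n ℕ.* (n C suc k)
      ≡⟨ solve 4 (λ z n x y → z :+ n :* x :+ n :* y := z :+ n :* (x :+ y)) refl (suc n C suc k) (suc n) (n C k) (n C suc k) ⟩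
    suc n C suc k ℕ.+ suc n ℕ.* (n C k ℕ.+ n C suc k)
      ≡⟨ cong (λ x → suc n C suc k ℕ.+ suc n ℕ.* x) (nCk+nC[k+1]≡[n+1]C[k+1] n k) ⟩
    suc (suc n) ℕ.* (suc n C suc k) ∎
    where open +-*-Solver
... | inj₁ p∣k = ⊥-elim (ℕ.<⇒≱ k<p (∣⇒≤ p∣k))
... | inj₂ p∣C = p∣C

S-above : ∀ {n k} → n < k → S n k ≡ 0
S-above {zero}  {suc k} _ = refl
S-above {suc n} {suc k} (s≤s n<k) = cong₂ ℕ._+_
  (trans (cong (suc k ℕ.*_) (S-above (ℕ.m<n⇒m<1+n n<k))) (ℕ.*-zeroʳ (suc k))) (S-above n<k)

S-diagonal : ∀ n → S n n ≡ 1
S-diagonal zero = refl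
S-diagonal (suc n) = cong₂ ℕ._+_
  (trans (cong (suc n ℕ.*_) (S-above (ℕ.n<1+n n))) (ℕ.*-zeroʳ (suc n))) (S-diagonal n)

S-zero : ∀ n .{{_ : NonZero n}} → S n 0 ≡ 0
S-zero (suc n) = refl

S-one : ∀ n .{{_ : NonZero n}} → S n 1 ≡ 1
S-one (suc zero) = refl
S-one (suc n@(suc _)) = trans (ℕ.+-identityʳ _) (trans (ℕ.*-identityˡ _) (S-one n))

-- Multiplying by p^(a+1) turns the exponent of the j-th term into that of the next one; adding that
-- power once raises its coefficient from j to j+1, so the shifted sum telescopes.
sumN-τ-shift : ∀ p a n →
  sumN n (λ j → j ℕ.* p ℕ.^ (j ℕ.* suc a ∸ 1)) ℕ.* p ℕ.^ suc a ℕ.+ sumN n (λ j → p ℕ.^ (j ℕ.* suc a ℕ.+ a))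
  ≡ sumN n (λ j → j ℕ.* p ℕ.^ (j ℕ.* suc a ∸ 1)) ℕ.+ n ℕ.* p ℕ.^ (n ℕ.* suc a ∸ 1)
sumN-τ-shift p a zero = refl
sumN-τ-shift p a (suc n) = begin
  (s ℕ.+ n ℕ.* x n) ℕ.* P ℕ.+ (r ℕ.+ p ℕ.^ (n ℕ.* suc a ℕ.+ a))
    ≡⟨ cong (λ y → (s ℕ.+ n ℕ.* x n) ℕ.* P ℕ.+ (r ℕ.+ p ℕ.^ y)) (ℕ.+-comm (n ℕ.* suc a) a) ⟩
  (s ℕ.+ n ℕ.* x n) ℕ.* P ℕ.+ (r ℕ.+ x (suc n))
    ≡⟨ solve 6 (λ s n x P r y → (s :+ n :* x) :* P :+ (r :+ y) := (s :* P :+ r) :+ (n :* (x :* P) :+ y)) refl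
         s n (x n) P r (x (suc n)) ⟩
  (s ℕ.* P ℕ.+ r) ℕ.+ (n ℕ.* (x n ℕ.* P) ℕ.+ x (suc n))
    ≡⟨ cong₂ (λ y z → y ℕ.+ (z ℕ.+ x (suc n))) (sumN-τ-shift p a n) (x-step n) ⟩
  (s ℕ.+ n ℕ.* x n) ℕ.+ (n ℕ.* x (suc n) ℕ.+ x (suc n))
    ≡⟨ cong ((s ℕ.+ n ℕ.* x n) ℕ.+_) (ℕ.+-comm (n ℕ.* x (suc n)) (x (suc n))) ⟩
  (s ℕ.+ n ℕ.* x n) ℕ.+ suc n ℕ.* x (suc n) ∎
  where
  open +-*-Solver
  P = p ℕ.^ suc a
  x : ℕ → ℕ
  x n = p ℕ.^ (n ℕ.* suc a ∸ 1)
  s = sumN n (λ j → j ℕ.* x j)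
  r = sumN n (λ j → p ℕ.^ (j ℕ.* suc a ℕ.+ a))
  x-step : ∀ n → n ℕ.* (x n ℕ.* P) ≡ n ℕ.* x (suc n)
  -- Truncated subtraction makes `x 0` equal to 1, so `x n * P` need not be `x (suc n)` at n = 0;
  -- the coefficient n = 0 absorbs this.
  x-step zero    = refl
  x-step (suc n) = cong (suc n ℕ.*_) (trans (sym (ℕ.^-distribˡ-+-* p (a ℕ.+ n ℕ.* suc a) (suc a)))
    (cong (p ℕ.^_) (trans (ℕ.+-comm (a ℕ.+ n ℕ.* suc a) (suc a)) (sym (ℕ.+-suc a _)))))

-- The boundary term p · p^(p(a+1)-1) is the full power p^(p(a+1)); as an exponent of θ it is the
-- iterate ψ^p, which fixes θ.
τ-shift : ∀ p a .{{_ : NonZero p}} →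
  τ p (suc a) ℕ.* p ℕ.^ suc a ℕ.+ sumN p (λ j → p ℕ.^ (j ℕ.* suc a ℕ.+ a))
  ≡ τ p (suc a) ℕ.+ p ℕ.^ (p ℕ.* suc a)
τ-shift p@(suc _) a = sumN-τ-shift p a p

monomialN-diagonal : ∀ c e → monomialN c e e ≡ c
monomialN-diagonal c zero    = refl
monomialN-diagonal c (suc e) = monomialN-diagonal c e

monomialN-off-diagonal : ∀ c e k → k ≢ e → monomialN c e k ≡ 0
monomialN-off-diagonal c zero    zero    0≢0 = ⊥-elim (0≢0 refl)
monomialN-off-diagonal c zero    (suc k) _   = refl
monomialN-off-diagonal c (suc e) zero    _   = refl
monomialN-off-diagonal c (suc e) (suc k) k≢e = monomialN-off-diagonal c e k (k≢e ∘ cong suc)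

-- Finite sums, Stirling recurrences and Bell coefficients in a commutative ring.

module PropositionalRing
  {A : Set} {_+′_ _*′_ : A → A → A} { -′_ : A → A} {0′ 1′ : A}
  (isCommutativeRing : IsCommutativeRing _≡_ _+′_ _*′_ -′_ 0′ 1′) where

  ring : CommutativeRing 0ℓ 0ℓ
  ring = record { isCommutativeRing = isCommutativeRing }

  open CommutativeRing ring public using
    ( _+_; _*_; -_; 0#; 1#; +-assoc; +-comm; +-identityˡ; +-identityʳ; -‿inverseˡ; -‿inverseʳ
    ; +-congˡ; +-congʳ; *-congˡ; *-congʳ; *-assoc; *-comm; *-identityˡ; *-identityʳ; distribˡ; distribʳ; zeroˡ; zeroʳ )
  open import Algebra.Properties.Ring (CommutativeRing.ring ring) public
    using (-‿distribˡ-*; -‿distribʳ-*; -‿involutive; +-cancelˡ)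
  open import Algebra.Properties.CommutativeSemiring.Exp (CommutativeRing.commutativeSemiring ring) public
    using (_^_; ^-homo-*; ^-assocʳ; ^-distrib-*)
  open import Algebra.Properties.Semiring.Mult (CommutativeRing.semiring ring) public
    using (_×_; ×-homo-+; ×1-homo-*; ×-assoc-*)
  open import Algebra.Properties.CommutativeMonoid.Sum (CommutativeRing.+-commutativeMonoid ring) public
    using (sum; sum-init-last; sum-cong-≗; sum-replicate-zero; sum-permute)
  open import Algebra.Properties.CommutativeSemiring.Binomial (CommutativeRing.commutativeSemiring ring)
    using () renaming (theorem to binomial-theorem)
  open import Algebra.Solver.Ring.NaturalCoefficients.Default (CommutativeRing.commutativeSemiring ring) public
    using (solve; _:=_; _:+_; _:*_; con)

  ν : ℕ → A
  ν n = n × 1#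

  Σ : ℕ → (ℕ → A) → A
  Σ zero    f = 0#
  Σ (suc n) f = Σ n f + f n

  ν-+ : ∀ m n → ν (m ℕ.+ n) ≡ ν m + ν n
  ν-+ = ×-homo-+ 1#

  ν-* : ∀ m n → ν (m ℕ.* n) ≡ ν m * ν n
  ν-* = ×1-homo-*

  ν-1 : ν 1 ≡ 1#
  ν-1 = +-identityʳ 1#

  ν-^ : ∀ m n → ν (m ℕ.^ n) ≡ ν m ^ n
  ν-^ m zero    = ν-1
  ν-^ m (suc n) = trans (ν-* m (m ℕ.^ n)) (cong (ν m *_) (ν-^ m n))

  1^ : ∀ n → 1# ^ n ≡ 1#
  1^ zero    = refl
  1^ (suc n) = trans (*-identityˡ _) (1^ n)

  0^ : ∀ n .{{_ : NonZero n}} → 0# ^ n ≡ 0#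
  0^ (suc n) = zeroˡ _

  Σ-cong : ∀ n {f g} → (∀ k → k < n → f k ≡ g k) → Σ n f ≡ Σ n g
  Σ-cong zero    f≡g = refl
  Σ-cong (suc n) f≡g = cong₂ _+_ (Σ-cong n λ k k<n → f≡g k (ℕ.m<n⇒m<1+n k<n)) (f≡g n (ℕ.n<1+n n))

  Σ-zero : ∀ n {f} → (∀ k → k < n → f k ≡ 0#) → Σ n f ≡ 0#
  Σ-zero zero    f≡0 = refl
  Σ-zero (suc n) f≡0 = trans
    (cong₂ _+_ (Σ-zero n λ k k<n → f≡0 k (ℕ.m<n⇒m<1+n k<n)) (f≡0 n (ℕ.n<1+n n))) (+-identityʳ 0#)

  Σ-+ : ∀ n f g → Σ n (λ k → f k + g k) ≡ Σ n f + Σ n g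
  Σ-+ zero    f g = sym (+-identityʳ 0#)
  Σ-+ (suc n) f g = trans (cong (_+ (f n + g n)) (Σ-+ n f g))
    (solve 4 (λ x y z w → (x :+ y) :+ (z :+ w) := (x :+ z) :+ (y :+ w)) refl (Σ n f) (Σ n g) (f n) (g n))

  Σ-additive : (h : A → A) → h 0# ≡ 0# → (∀ x y → h (x + y) ≡ h x + h y) →
               ∀ n f → h (Σ n f) ≡ Σ n (λ k → h (f k))
  Σ-additive h h0 h+ zero    f = h0
  Σ-additive h h0 h+ (suc n) f = trans (h+ _ _) (cong (_+ h (f n)) (Σ-additive h h0 h+ n f))

  Σ-*ˡ : ∀ c n f → c * Σ n f ≡ Σ n (λ k → c * f k)
  Σ-*ˡ c = Σ-additive (c *_) (zeroʳ c) (distribˡ c)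

  Σ-*ʳ : ∀ c n f → Σ n f * c ≡ Σ n (λ k → f k * c)
  Σ-*ʳ c = Σ-additive (_* c) (zeroˡ c) (distribʳ c)

  Σ-head : ∀ n f → Σ (suc n) f ≡ f 0 + Σ n (f ∘ suc)
  Σ-head zero    f = trans (+-identityˡ (f 0)) (sym (+-identityʳ (f 0)))
  Σ-head (suc n) f = trans (cong (_+ f (suc n)) (Σ-head n f)) (+-assoc _ _ _)

  Σ-single : ∀ n f {i} → i < n → (∀ k → k < n → k ≢ i → f k ≡ 0#) → Σ n f ≡ f i
  Σ-single (suc n) f {i} i<n f≡0 with i ℕ.≟ n
  ... | yes refl = trans
    (cong (_+ f n) (Σ-zero n λ k k<n → f≡0 k (ℕ.m<n⇒m<1+n k<n) (ℕ.<⇒≢ k<n))) (+-identityˡ (f n))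
  ... | no i≢n = trans
    (cong₂ _+_ (Σ-single n f (ℕ.≤∧≢⇒< (ℕ.≤-pred i<n) i≢n) λ k k<n → f≡0 k (ℕ.m<n⇒m<1+n k<n))
               (f≡0 n (ℕ.n<1+n n) (i≢n ∘ sym)))
    (+-identityʳ (f i))

  Σ-pair : ∀ n f {i j} → i < j → j < n → (∀ k → k < n → k ≢ i → k ≢ j → f k ≡ 0#) → Σ n f ≡ f i + f j
  Σ-pair (suc n) f {i} {j} i<j j<n f≡0 with j ℕ.≟ n
  ... | yes refl = cong (_+ f n) (Σ-single n f i<j λ k k<n k≢i → f≡0 k (ℕ.m<n⇒m<1+n k<n) k≢i (ℕ.<⇒≢ k<n))
  ... | no j≢n = trans
    (cong₂ _+_ (Σ-pair n f i<j j<n′ λ k k<n → f≡0 k (ℕ.m<n⇒m<1+n k<n))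
               (f≡0 n (ℕ.n<1+n n) (ℕ.<⇒≢ (ℕ.<-trans i<j j<n′) ∘ sym) (j≢n ∘ sym)))
    (+-identityʳ (f i + f j))
    where j<n′ = ℕ.≤∧≢⇒< (ℕ.≤-pred j<n) j≢n

  Σ≡sum : ∀ n f → Σ n f ≡ sum {n} (f ∘ toℕ)
  Σ≡sum zero    f = refl
  Σ≡sum (suc n) f = trans (Σ-head n f) (cong (f 0 +_) (Σ≡sum n (f ∘ suc)))

  ∣⇒×≡0 : ∀ {p n} → ν p ≡ 0# → p ∣ n → ∀ x → n × x ≡ 0#
  ∣⇒×≡0 {p} νp≡0 (divides q refl) x = begin
    (q ℕ.* p) × x          ≡⟨ cong ((q ℕ.* p) ×_) (*-identityˡ x) ⟨
    (q ℕ.* p) × (1# * x)   ≡⟨ ×-assoc-* (q ℕ.* p) 1# x ⟨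
    ν (q ℕ.* p) * x        ≡⟨ cong (_* x) (trans (ν-* q p) (trans (cong (ν q *_) νp≡0) (zeroʳ (ν q)))) ⟩
    0# * x                 ≡⟨ zeroˡ x ⟩
    0#                     ∎

  -- Modelled on q n k = yⁿ · y(y - α)⋯(y - (k-1)α), but applied also to derivatives and
  -- traces of these terms, which satisfy the same recurrence.
  stirling-expansion : ∀ {α ξ} → α * ξ ≡ 1# → (q : ℕ → ℕ → A) →
    (∀ n k → q (suc n) k ≡ q n (suc k) + ν k * (α * q n k)) →
    ∀ n m N → n < N → q (n ℕ.+ m) 0 ≡ Σ N (λ k → ν (S n k) * (α ^ n * ξ ^ k * q m k))
  stirling-expansion {α} {ξ} αξ≡1 q q-rec zero m N 0<N = sym (begin
    Σ N (λ k → ν (S 0 k) * (1# * ξ ^ k * q m k))  ≡⟨ Σ-single N _ 0<N off ⟩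
    ν 1 * (1# * 1# * q m 0)  ≡⟨ cong₂ _*_ ν-1 (trans (cong (_* q m 0) (*-identityˡ 1#)) (*-identityˡ _)) ⟩
    1# * q m 0               ≡⟨ *-identityˡ _ ⟩
    q m 0                    ∎)
    where
    off : ∀ k → k < N → k ≢ 0 → ν (S 0 k) * (1# * ξ ^ k * q m k) ≡ 0#
    off zero    _ 0≢0 = ⊥-elim (0≢0 refl)
    off (suc k) _ _   = zeroˡ _
  stirling-expansion {α} {ξ} αξ≡1 q q-rec (suc n) m (suc N) (s≤s n<N) = begin
    q (suc n ℕ.+ m) 0
      ≡⟨ cong (λ i → q i 0) (ℕ.+-suc n m) ⟨
    q (n ℕ.+ suc m) 0
      ≡⟨ stirling-expansion αξ≡1 q q-rec n (suc m) N n<N ⟩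
    Σ N (λ k → ν (S n k) * (α ^ n * ξ ^ k * q (suc m) k))
      ≡⟨ Σ-cong N (λ k _ → split k) ⟩
    Σ N (λ k → g k + h k)
      ≡⟨ Σ-+ N g h ⟩
    Σ N g + Σ N h
      ≡⟨ cong (_+ Σ N h) shift ⟩
    Σ N (g ∘ suc) + Σ N h
      ≡⟨ Σ-+ N (g ∘ suc) h ⟨
    Σ N (λ k → g (suc k) + h k)
      ≡⟨ Σ-cong N (λ k _ → merge k) ⟩
    Σ N (λ k → ν (S (suc n) (suc k)) * (α ^ suc n * ξ ^ suc k * q m (suc k)))
      ≡⟨ trans (Σ-head N _) (trans (+-congʳ (zeroˡ _)) (+-identityˡ _)) ⟨
    Σ (suc N) (λ k → ν (S (suc n) k) * (α ^ suc n * ξ ^ k * q m k)) ∎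
    where
    g h : ℕ → A
    g k = ν k * (ν (S n k) * (α ^ suc n * ξ ^ k * q m k))
    h k = ν (S n k) * (α ^ n * ξ ^ k * q m (suc k))
    split : ∀ k → ν (S n k) * (α ^ n * ξ ^ k * q (suc m) k) ≡ g k + h k
    split k = trans (cong (λ z → ν (S n k) * (α ^ n * ξ ^ k * z)) (q-rec m k))
      (solve 7 (λ s a x q′ k α q → s :* (a :* x :* (q′ :+ k :* (α :* q)))
          := k :* (s :* (α :* a :* x :* q)) :+ s :* (a :* x :* q′))
        refl (ν (S n k)) (α ^ n) (ξ ^ k) (q m (suc k)) (ν k) α (q m k))
    -- Moving the index by one loses nothing: `g 0` carries the factor 0, and `g N` the Stirling
    -- number S(n,N), which vanishes as n < N.
    shift : Σ N g ≡ Σ N (g ∘ suc)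
    shift = begin
      Σ N g                ≡⟨ +-identityʳ _ ⟨
      Σ N g + 0#
        ≡⟨ cong (Σ N g +_) (trans (*-congˡ (trans (*-congʳ (cong ν (S-above n<N))) (zeroˡ _))) (zeroʳ _)) ⟨
      Σ (suc N) g          ≡⟨ Σ-head N g ⟩
      g 0 + Σ N (g ∘ suc)  ≡⟨ trans (+-congʳ (zeroˡ _)) (+-identityˡ _) ⟩
      Σ N (g ∘ suc)        ∎
    merge : ∀ k → g (suc k) + h k ≡ ν (S (suc n) (suc k)) * (α ^ suc n * ξ ^ suc k * q m (suc k))
    merge k = begin
      g (suc k) + ν (S n k) * (α ^ n * ξ ^ k * Q)
        -- Inserting 1 = αξ raises both exponents, so that the two summands share α^(n+1) ξ^(k+1).
        ≡⟨ cong (λ z → g (suc k) + ν (S n k) * z) (*-identityˡ _) ⟨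
      g (suc k) + ν (S n k) * (1# * (α ^ n * ξ ^ k * Q))
        ≡⟨ cong (λ z → g (suc k) + ν (S n k) * (z * (α ^ n * ξ ^ k * Q))) αξ≡1 ⟨
      g (suc k) + ν (S n k) * (α * ξ * (α ^ n * ξ ^ k * Q))
        ≡⟨ solve 8 (λ k s t α a ξ x Q →
             k :* (s :* (α :* a :* (ξ :* x) :* Q)) :+ t :* (α :* ξ :* (a :* x :* Q))
             := (k :* s :+ t) :* (α :* a :* (ξ :* x) :* Q))
           refl (ν (suc k)) (ν (S n (suc k))) (ν (S n k)) α (α ^ n) ξ (ξ ^ k) Q ⟩
      (ν (suc k) * ν (S n (suc k)) + ν (S n k)) * (α ^ suc n * ξ ^ suc k * Q)
        ≡⟨ *-congʳ (trans (ν-+ (suc k ℕ.* S n (suc k)) (S n k)) (cong (_+ ν (S n k)) (ν-* (suc k) (S n (suc k))))) ⟨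
      ν (S (suc n) (suc k)) * (α ^ suc n * ξ ^ suc k * Q) ∎
      where Q = q m (suc k)

  -- A step β of either sign makes this the rising or the falling factorial, so a single recurrence
  -- serves the products along ψ and along its inverse.
  rise : ℕ → A → A → A
  rise zero    y β = 1#
  rise (suc k) y β = rise k y β * (y + ν k * β)

  -- Replacing a factor y by y + kβ costs kβ = -kα. The relation is stated as a sum so that the pair
  -- can be read as α, -α and also as -α, α.
  rise-recurrence : ∀ {α β} → α + β ≡ 0# → ∀ y n k →
    y ^ suc n * rise k y β ≡ y ^ n * rise (suc k) y β + ν k * (α * (y ^ n * rise k y β))
  rise-recurrence {α} {β} α+β≡0 y n k = sym (begin
    y ^ n * (e * (y + ν k * β)) + ν k * (α * (y ^ n * e))
      ≡⟨ solve 6 (λ a e y k α β → a :* (e :* (y :+ k :* β)) :+ k :* (α :* (a :* e))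
           := y :* a :* e :+ k :* (a :* e) :* (α :+ β)) refl (y ^ n) e y (ν k) α β ⟩
    y * y ^ n * e + ν k * (y ^ n * e) * (α + β)
      ≡⟨ cong (λ z → y * y ^ n * e + z) (trans (cong (ν k * (y ^ n * e) *_) α+β≡0) (zeroʳ _)) ⟩
    y * y ^ n * e + 0#
      ≡⟨ +-identityʳ _ ⟩
    y ^ suc n * e ∎)
    where e = rise k y β

  ν-sumN : ∀ n f → ν (sumN n f) ≡ Σ n (λ k → ν (f k))
  ν-sumN zero    f = refl
  ν-sumN (suc n) f = trans (ν-+ (sumN n f) (f n)) (cong (_+ ν (f n)) (ν-sumN n f))

  ν-R : ∀ m j k → ν (R m j k) ≡ ν (m C k) * ν (S (m ∸ k) j)
  ν-R m j k with k ℕ.≤? m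
  ... | yes k≤m = begin
    ν (R m j k)                                    ≡⟨ ν-sumN (suc m) _ ⟩
    Σ (suc m) f                                    ≡⟨ Σ-single (suc m) f (s≤s (ℕ.m∸n≤m m k)) off ⟩
    f (m ∸ k)                                      ≡⟨ cong (λ e → ν (monomialN c e k)) (ℕ.m∸[m∸n]≡n k≤m) ⟩
    ν (monomialN c k k)                            ≡⟨ cong ν (monomialN-diagonal c k) ⟩
    ν c                                            ≡⟨ ν-* (m C (m ∸ k)) _ ⟩
    ν (m C (m ∸ k)) * ν (S (m ∸ k) j)              ≡⟨ *-congʳ (cong ν (nCk≡nC[n∸k] k≤m)) ⟨
    ν (m C k) * ν (S (m ∸ k) j)                    ∎
    where
    c = (m C (m ∸ k)) ℕ.* S (m ∸ k) j
    f : ℕ → A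
    f i = ν (monomialN ((m C i) ℕ.* S i j) (m ∸ i) k)
    off : ∀ i → i < suc m → i ≢ m ∸ k → f i ≡ 0#
    off i (s≤s i≤m) i≢m∸k = cong ν (monomialN-off-diagonal _ (m ∸ i) k λ k≡m∸i →
      i≢m∸k (trans (sym (ℕ.m∸[m∸n]≡n i≤m)) (cong (m ∸_) (sym k≡m∸i))))
  ... | no k≰m = begin
    ν (R m j k)                                    ≡⟨ ν-sumN (suc m) _ ⟩
    Σ (suc m) _
      ≡⟨ Σ-zero (suc m)
           (λ i _ → cong ν (monomialN-off-diagonal _ (m ∸ i) k λ k≡m∸i → k≰m (subst (_≤ m) (sym k≡m∸i) (ℕ.m∸n≤m m i)))) ⟩
    0#                                             ≡⟨ zeroˡ _ ⟨
    0# * ν (S (m ∸ k) j)                           ≡⟨ *-congʳ (cong ν (k>n⇒nCk≡0 (ℕ.≰⇒> k≰m))) ⟨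
    ν (m C k) * ν (S (m ∸ k) j)                    ∎

  -- For k > m the truncated difference breaks the law of exponents, but then the binomial
  -- coefficient is 0.
  ν-C-^-split : ∀ x m k → ν (m C k) * x ^ m ≡ ν (m C k) * (x ^ k * x ^ (m ∸ k))
  ν-C-^-split x m k with k ℕ.≤? m
  ... | yes k≤m = *-congˡ (trans (cong (x ^_) (sym (ℕ.m+[n∸m]≡n k≤m))) (^-homo-* x k (m ∸ k)))
  ... | no k≰m rewrite k>n⇒nCk≡0 (ℕ.≰⇒> k≰m) = trans (zeroˡ _) (sym (zeroˡ _))

  -- The factor `ν (m C k) * ν a ^ k` is split off because the λ^k coefficient of (aλ+θ)^m carries
  -- the same one; what remains is the Bell sum of degree m-k at λ = 0.
  ν-bell : ∀ a m b k → ν (a ℕ.^ m ℕ.* bell m b k) ≡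
    ν (m C k) * ν a ^ k * Σ (suc m) (λ j → ν (S (m ∸ k) j) * (ν a ^ (m ∸ k) * ν b ^ j))
  ν-bell a m b k = begin
    ν (a ℕ.^ m ℕ.* bell m b k)
      ≡⟨ trans (ν-* (a ℕ.^ m) _) (cong₂ _*_ (ν-^ a m) (ν-sumN (suc m) _)) ⟩
    ν a ^ m * Σ (suc m) (λ j → ν (R m j k ℕ.* b ℕ.^ j))
      ≡⟨ Σ-*ˡ (ν a ^ m) (suc m) _ ⟩
    Σ (suc m) (λ j → ν a ^ m * ν (R m j k ℕ.* b ℕ.^ j))
      ≡⟨ Σ-cong (suc m) (λ j _ → term j) ⟩
    Σ (suc m) (λ j → ν (m C k) * ν a ^ k * (ν (S (m ∸ k) j) * (ν a ^ (m ∸ k) * ν b ^ j)))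
      ≡⟨ Σ-*ˡ (ν (m C k) * ν a ^ k) (suc m) _ ⟨
    ν (m C k) * ν a ^ k * Σ (suc m) (λ j → ν (S (m ∸ k) j) * (ν a ^ (m ∸ k) * ν b ^ j)) ∎
    where
    term : ∀ j → ν a ^ m * ν (R m j k ℕ.* b ℕ.^ j)
               ≡ ν (m C k) * ν a ^ k * (ν (S (m ∸ k) j) * (ν a ^ (m ∸ k) * ν b ^ j))
    term j = begin
      ν a ^ m * ν (R m j k ℕ.* b ℕ.^ j)
        ≡⟨ *-congˡ (trans (ν-* (R m j k) _) (cong₂ _*_ (ν-R m j k) (ν-^ b j))) ⟩
      ν a ^ m * (ν (m C k) * ν (S (m ∸ k) j) * ν b ^ j)
        ≡⟨ solve 4 (λ x c s y → x :* (c :* s :* y) := c :* x :* (s :* y))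
             refl (ν a ^ m) (ν (m C k)) (ν (S (m ∸ k) j)) (ν b ^ j) ⟩
      ν (m C k) * ν a ^ m * (ν (S (m ∸ k) j) * ν b ^ j)
        ≡⟨ *-congʳ (ν-C-^-split (ν a) m k) ⟩
      ν (m C k) * (ν a ^ k * ν a ^ (m ∸ k)) * (ν (S (m ∸ k) j) * ν b ^ j)
        ≡⟨ solve 5 (λ c x z s y → c :* (x :* z) :* (s :* y) := c :* x :* (s :* (z :* y)))
             refl (ν (m C k)) (ν a ^ k) (ν a ^ (m ∸ k)) (ν (S (m ∸ k) j)) (ν b ^ j) ⟩
      ν (m C k) * ν a ^ k * (ν (S (m ∸ k) j) * (ν a ^ (m ∸ k) * ν b ^ j)) ∎

  -- This compares the coefficients of λ^(k+1) in (αλ+θ)(αλ+θ)^m: Pascal's rule joins the two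
  -- contributions once their powers of θ agree.
  ν-C-pascal : ∀ θ α m k →
    θ * (ν (m C suc k) * α ^ suc k * θ ^ (m ∸ suc k)) + α * (ν (m C k) * α ^ k * θ ^ (m ∸ k))
    ≡ ν (suc m C suc k) * α ^ suc k * θ ^ (suc m ∸ suc k)
  ν-C-pascal θ α m k = begin
    θ * (ν (m C suc k) * α ^ suc k * θ ^ (m ∸ suc k)) + α * (ν (m C k) * α ^ k * θ ^ (m ∸ k))
      ≡⟨ solve 7 (λ θ c x y t d s → θ :* (c :* (x :* y) :* t) :+ x :* (d :* y :* s) := c :* (θ :* t) :* (x :* y) :+ d :* s :* (x :* y)) refl
           θ (ν (m C suc k)) α (α ^ k) (θ ^ (m ∸ suc k)) (ν (m C k)) (θ ^ (m ∸ k)) ⟩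
    ν (m C suc k) * θ ^ suc (m ∸ suc k) * α ^ suc k + ν (m C k) * θ ^ (m ∸ k) * α ^ suc k
      ≡⟨ +-congʳ (*-congʳ power) ⟩
    ν (m C suc k) * θ ^ (m ∸ k) * α ^ suc k + ν (m C k) * θ ^ (m ∸ k) * α ^ suc k
      ≡⟨ solve 4 (λ c d t x → c :* t :* x :+ d :* t :* x := (d :+ c) :* x :* t) refl
           (ν (m C suc k)) (ν (m C k)) (θ ^ (m ∸ k)) (α ^ suc k) ⟩
    (ν (m C k) + ν (m C suc k)) * α ^ suc k * θ ^ (m ∸ k)
      ≡⟨ *-congʳ (*-congʳ (trans (sym (ν-+ (m C k) (m C suc k))) (cong ν (nCk+nC[k+1]≡[n+1]C[k+1] m k)))) ⟩
    ν (suc m C suc k) * α ^ suc k * θ ^ (m ∸ k) ∎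
    where
    -- For k ≥ m the two exponents differ by truncation, and the factor C(m,k+1) = 0 hides it.
    power : ν (m C suc k) * θ ^ suc (m ∸ suc k) ≡ ν (m C suc k) * θ ^ (m ∸ k)
    power with suc k ℕ.≤? m
    ... | yes k<m = *-congˡ (cong (θ ^_) (sym (ℕ.+-∸-assoc 1 k<m)))
    ... | no k≮m rewrite k>n⇒nCk≡0 (ℕ.≰⇒> k≮m) = trans (zeroˡ _) (sym (zeroˡ _))

  -- Prime characteristic: additivity of Frobenius and Stirling numbers modulo p.

  module PrimeCharacteristic {p} (pp : Prime p) (νp≡0 : ν p ≡ 0#) where

    frobenius-+ : ∀ x y → (x + y) ^ p ≡ x ^ p + y ^ p
    frobenius-+ x y = go p refl
      where
      go : ∀ n → n ≡ p → (x + y) ^ n ≡ x ^ n + y ^ n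
      go zero refl = ⊥-elim (ℕ.≢-nonZero⁻¹ 0 {{prime⇒nonZero pp}} refl)
      go (suc q) refl = begin
        (x + y) ^ suc q                        ≡⟨ binomial-theorem (suc q) x y ⟩
        t Fin.zero + sum (t ∘ Fin.suc)         ≡⟨ cong (t Fin.zero +_) (sum-init-last (t ∘ Fin.suc)) ⟩
        t Fin.zero + (sum (λ i → t (Fin.suc (inject₁ i))) + t (Fin.suc (fromℕ q)))
          ≡⟨ cong₂ _+_ first (cong₂ _+_ middle last′) ⟩
        y ^ suc q + (0# + x ^ suc q)           ≡⟨ cong (y ^ suc q +_) (+-identityˡ _) ⟩
        y ^ suc q + x ^ suc q                  ≡⟨ +-comm _ _ ⟩
        x ^ suc q + y ^ suc q                  ∎
        where
        t : Fin (suc (suc q)) → A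
        t i = (suc q C toℕ i) × (x ^ toℕ i * y ^ (suc q ∸ toℕ i))
        first : t Fin.zero ≡ y ^ suc q
        first = trans (+-identityʳ _) (*-identityˡ _)
        last′ : t (Fin.suc (fromℕ q)) ≡ x ^ suc q
        last′ = begin
          (suc q C suc (toℕ (fromℕ q))) × (x ^ suc (toℕ (fromℕ q)) * y ^ (q ∸ toℕ (fromℕ q)))
            ≡⟨ cong (λ j → (suc q C suc j) × (x ^ suc j * y ^ (q ∸ j))) (Fin.toℕ-fromℕ q) ⟩
          (suc q C suc q) × (x ^ suc q * y ^ (q ∸ q))
            ≡⟨ cong₂ (λ c j → c × (x ^ suc q * y ^ j)) (nCn≡1 (suc q)) (ℕ.n∸n≡0 q) ⟩
          1 × (x ^ suc q * 1#)  ≡⟨ trans (+-identityʳ _) (*-identityʳ _) ⟩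
          x ^ suc q             ∎
        middle : sum (λ i → t (Fin.suc (inject₁ i))) ≡ 0#
        middle = trans
          (sum-cong-≗ λ i → ∣⇒×≡0 νp≡0 (prime∣binomial pp
            (s≤s (subst (_< q) (sym (Fin.toℕ-inject₁ i)) (Fin.toℕ<n i)))) _)
          (sum-replicate-zero q)

    -- Reducing a Bézout identity modulo p removes the multiple of p; the two shapes of the identity
    -- account for the sign of the inverse.
    unit : ∀ {n} → 0 < n → n < p → ∃ λ z → z * ν n ≡ 1#
    unit {n} 0<n n<p with coprime-Bézout (prime⇒coprime pp {{ℕ.>-nonZero 0<n}} n<p)
    ... | Bézout.-+ x y 1+xp≡yn = ν y , (begin
      ν y * ν n           ≡⟨ ν-* y n ⟨
      ν (y ℕ.* n)         ≡⟨ cong ν 1+xp≡yn ⟨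
      1# + ν (x ℕ.* p)    ≡⟨ cong (1# +_) (∣⇒×≡0 νp≡0 (divides x refl) 1#) ⟩
      1# + 0#             ≡⟨ +-identityʳ 1# ⟩
      1#                  ∎)
    ... | Bézout.+- x y 1+yn≡xp = - ν y , (begin
      - ν y * ν n                ≡⟨ -‿distribˡ-* (ν y) (ν n) ⟨
      - (ν y * ν n)              ≡⟨ +-identityˡ _ ⟨
      0# + - (ν y * ν n)         ≡⟨ +-congʳ (∣⇒×≡0 νp≡0 (divides x refl) 1#) ⟨
      ν (x ℕ.* p) + - (ν y * ν n)  ≡⟨ cong (λ z → ν z + - (ν y * ν n)) 1+yn≡xp ⟨
      1# + ν (y ℕ.* n) + - (ν y * ν n)  ≡⟨ +-congʳ (+-congˡ (ν-* y n)) ⟩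
      1# + ν y * ν n + - (ν y * ν n)    ≡⟨ +-assoc _ _ _ ⟩
      1# + (ν y * ν n + - (ν y * ν n))  ≡⟨ cong (1# +_) (-‿inverseʳ _) ⟩
      1# + 0#                    ≡⟨ +-identityʳ 1# ⟩
      1#                         ∎)

    ν-cancelˡ : ∀ {n y} → 0 < n → n < p → ν n * y ≡ 0# → y ≡ 0#
    ν-cancelˡ {n} {y} 0<n n<p ny≡0 with z , zn≡1 ← unit 0<n n<p = begin
      y              ≡⟨ *-identityˡ y ⟨
      1# * y         ≡⟨ cong (_* y) zn≡1 ⟨
      z * ν n * y    ≡⟨ *-assoc z (ν n) y ⟩
      z * (ν n * y)  ≡⟨ cong (z *_) ny≡0 ⟩
      z * 0#         ≡⟨ zeroʳ z ⟩
      0#             ∎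

    -- Fermat's little theorem: Frobenius is additive and `ν n` is a sum of ones.
    frobenius-ν : ∀ n → ν n ^ p ≡ ν n
    frobenius-ν zero    = 0^ p {{prime⇒nonZero pp}}
    frobenius-ν (suc n) = trans (frobenius-+ 1# (ν n)) (cong₂ _+_ (1^ p) (frobenius-ν n))

    -- Additivity forces the sign, which treats p = 2 and odd p alike without evaluating (-1)^p.
    frobenius-neg : ∀ y → (- y) ^ p ≡ - (y ^ p)
    frobenius-neg y = +-cancelˡ (y ^ p) _ _ (begin
      y ^ p + (- y) ^ p   ≡⟨ frobenius-+ y (- y) ⟨
      (y + - y) ^ p       ≡⟨ cong (_^ p) (-‿inverseʳ y) ⟩
      0# ^ p              ≡⟨ 0^ p {{prime⇒nonZero pp}} ⟩
      0#                  ≡⟨ -‿inverseʳ _ ⟨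
      y ^ p + - (y ^ p)   ∎)

    private
      νj-νk : ∀ {j k} → k ≤ j → ν j + ν k * - 1# ≡ ν (j ∸ k)
      νj-νk {j} {k} k≤j = begin
        ν j + ν k * - 1#                 ≡⟨ cong (λ i → ν i + ν k * - 1#) (ℕ.m∸n+n≡m k≤j) ⟨
        ν (j ∸ k ℕ.+ k) + ν k * - 1#
          ≡⟨ cong₂ _+_ (ν-+ (j ∸ k) k) (trans (sym (-‿distribʳ-* (ν k) 1#)) (cong -_ (*-identityʳ _))) ⟩
        ν (j ∸ k) + ν k + - ν k
          ≡⟨ trans (+-assoc _ _ _) (trans (cong (ν (j ∸ k) +_) (-‿inverseʳ _)) (+-identityʳ _)) ⟩
        ν (j ∸ k)                        ∎

      rise-vanishes : ∀ {j} k → j < k → rise k (ν j) (- 1#) ≡ 0#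
      rise-vanishes {j} (suc k) (s≤s j≤k) with j ℕ.≟ k
      ... | yes refl = trans (*-congˡ (trans (νj-νk {j} ℕ.≤-refl) (cong ν (ℕ.n∸n≡0 j)))) (zeroʳ _)
      ... | no j≢k = trans (*-congʳ (rise-vanishes k (ℕ.≤∧≢⇒< j≤k j≢k))) (zeroˡ _)

      -- The factors j, j-1, ..., j-k+1 are positive and smaller than p, hence units that can be
      -- removed one at a time.
      rise-cancelˡ : ∀ {j y} k → k ≤ j → j < p → rise k (ν j) (- 1#) * y ≡ 0# → y ≡ 0#
      rise-cancelˡ zero _ _ y≡0 = trans (sym (*-identityˡ _)) y≡0
      rise-cancelˡ {j} {y} (suc k) k<j j<p ey≡0 =
        ν-cancelˡ (ℕ.m<n⇒0<n∸m k<j) (ℕ.≤-<-trans (ℕ.m∸n≤m j k) j<p)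
          (trans (cong (_* y) (sym (νj-νk (ℕ.<⇒≤ k<j))))
            (rise-cancelˡ k (ℕ.<⇒≤ k<j) j<p (trans (sym (*-assoc _ _ y)) ey≡0)))

    -- t^p agrees with t at t = 0, …, p - 1, and evaluating its Newton expansion
    -- Σ S(p,k) t(t-1)⋯(t-k+1) there successively kills the coefficients.
    S[p,k]≡0 : ∀ k → 2 ≤ k → k < p → ν (S p k) ≡ 0#
    S[p,k]≡0 = <-rec (λ k → 2 ≤ k → k < p → ν (S p k) ≡ 0#) step
      where
      step : ∀ j → (∀ {k} → k < j → 2 ≤ k → k < p → ν (S p k) ≡ 0#) → 2 ≤ j → j < p → ν (S p j) ≡ 0#
      step j ih 2≤j j<p = rise-cancelˡ j ℕ.≤-refl j<p (trans (*-comm _ _) (trans (sym (f≡ j)) fj≡0))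
        where
        q : ℕ → ℕ → A
        q n k = ν j ^ n * rise k (ν j) (- 1#)
        f : ℕ → A
        f k = ν (S p k) * (1# ^ p * 1# ^ k * q 0 k)
        f≡ : ∀ k → f k ≡ ν (S p k) * rise k (ν j) (- 1#)
        f≡ k = cong (ν (S p k) *_) (trans (cong₂ _*_ (cong₂ _*_ (1^ p) (1^ k)) (*-identityˡ _))
          (trans (*-congʳ (*-identityˡ 1#)) (*-identityˡ _)))
        f1≡ : f 1 ≡ ν j
        f1≡ = begin
          f 1                                       ≡⟨ f≡ 1 ⟩
          ν (S p 1) * (1# * (ν j + 0# * - 1#))
            ≡⟨ cong₂ _*_ (trans (cong ν (S-one p {{prime⇒nonZero pp}})) ν-1)
                 (trans (*-identityˡ _) (trans (cong (ν j +_) (zeroˡ _)) (+-identityʳ _))) ⟩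
          1# * ν j                                  ≡⟨ *-identityˡ _ ⟩
          ν j                                       ∎
        off : ∀ k → k < suc p → k ≢ 1 → k ≢ j → f k ≡ 0#
        off zero _ _ _ = trans (*-congʳ (cong ν (S-zero p {{prime⇒nonZero pp}}))) (zeroˡ _)
        off (suc zero) _ 1≢1 _ = ⊥-elim (1≢1 refl)
        off k@(suc (suc _)) _ _ k≢j with ℕ.<-cmp k j
        ... | tri< k<j _ _ = trans (*-congʳ (ih k<j (s≤s (s≤s z≤n)) (ℕ.<-trans k<j j<p))) (zeroˡ _)
        ... | tri≈ _ k≡j _ = ⊥-elim (k≢j k≡j)
        ... | tri> _ _ j<k = trans (f≡ k) (trans (*-congˡ (rise-vanishes k j<k)) (zeroʳ _))
        -- The whole expansion equals j^p = j, and its term at 1 is already j, so nothing is left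
        -- for the term at j.
        fj≡0 : f j ≡ 0#
        fj≡0 = +-cancelˡ (ν j) _ _ (begin
          ν j + f j        ≡⟨ cong (_+ f j) f1≡ ⟨
          f 1 + f j        ≡⟨ Σ-pair (suc p) f 2≤j (ℕ.m<n⇒m<1+n j<p) off ⟨
          Σ (suc p) f
            ≡⟨ stirling-expansion (*-identityˡ 1#) q (rise-recurrence (-‿inverseʳ 1#) (ν j)) p 0 (suc p) (ℕ.n<1+n p) ⟨
          q (p ℕ.+ 0) 0    ≡⟨ cong (λ n → q n 0) (ℕ.+-identityʳ p) ⟩
          ν j ^ p * 1#     ≡⟨ *-identityʳ _ ⟩
          ν j ^ p          ≡⟨ frobenius-ν j ⟩
          ν j              ≡⟨ +-identityʳ _ ⟨
          ν j + 0#         ∎)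

    -- Modulo p only S(p,1) and S(p,p) survive, and α^p ξ = α^p ξ^p = 1. For q built from powers of
    -- y this is the factorisation of y^p - y into the p factors y - iα; an arbitrary q makes it
    -- apply to the derivative of that identity too.
    stirling-frobenius : ∀ {α ξ} → α * ξ ≡ 1# → α ^ p ≡ α → (q : ℕ → ℕ → A) →
      (∀ n k → q (suc n) k ≡ q n (suc k) + ν k * (α * q n k)) → q p 0 ≡ q 0 1 + q 0 p
    stirling-frobenius {α} {ξ} αξ≡1 αᵖ≡α q q-rec = begin
      q p 0          ≡⟨ cong (λ n → q n 0) (ℕ.+-identityʳ p) ⟨
      q (p ℕ.+ 0) 0  ≡⟨ stirling-expansion αξ≡1 q q-rec p 0 (suc p) (ℕ.n<1+n p) ⟩
      Σ (suc p) f    ≡⟨ Σ-pair (suc p) f 1<p (ℕ.n<1+n p) off ⟩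
      f 1 + f p      ≡⟨ cong₂ _+_ f1≡ fp≡ ⟩
      q 0 1 + q 0 p  ∎
      where
      1<p : 1 < p
      1<p = ℕ.nonTrivial⇒n>1 p {{prime⇒nonTrivial pp}}
      f : ℕ → A
      f k = ν (S p k) * (α ^ p * ξ ^ k * q 0 k)
      off : ∀ k → k < suc p → k ≢ 1 → k ≢ p → f k ≡ 0#
      off zero _ _ _ = trans (*-congʳ (cong ν (S-zero p {{prime⇒nonZero pp}}))) (zeroˡ _)
      off (suc zero) _ 1≢1 _ = ⊥-elim (1≢1 refl)
      off k@(suc (suc _)) (s≤s k≤p) _ k≢p =
        trans (*-congʳ (S[p,k]≡0 k (s≤s (s≤s z≤n)) (ℕ.≤∧≢⇒< k≤p k≢p))) (zeroˡ _)
      scaled : ∀ {s x z} → ν s ≡ 1# → x ≡ 1# → ν s * (x * z) ≡ z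
      scaled {s} {x} {z} s≡1 x≡1 = trans (cong₂ (λ s x → s * (x * z)) s≡1 x≡1) (trans (*-identityˡ _) (*-identityˡ z))
      f1≡ : f 1 ≡ q 0 1
      f1≡ = scaled {S p 1} (trans (cong ν (S-one p {{prime⇒nonZero pp}})) ν-1) (trans (cong₂ _*_ αᵖ≡α (*-identityʳ ξ)) αξ≡1)
      fp≡ : f p ≡ q 0 p
      fp≡ = scaled {S p p} (trans (cong ν (S-diagonal p)) ν-1)
        (trans (sym (^-distrib-* α ξ p)) (trans (cong (_^ p) αξ≡1) (1^ p)))

    -- Iterates of Frobenius and the trace as their sum.

    private instance
      p≢0 : NonZero p
      p≢0 = prime⇒nonZero pp

    frob : ℕ → A → A
    frob i y = y ^ (p ℕ.^ i)

    frob-∘ : ∀ i j y → frob (i ℕ.+ j) y ≡ frob i (frob j y)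
    frob-∘ i j y = trans
      (cong (y ^_) (trans (ℕ.^-distribˡ-+-* p i j) (ℕ.*-comm (p ℕ.^ i) (p ℕ.^ j))))
      (sym (^-assocʳ y (p ℕ.^ j) (p ℕ.^ i)))

    frob-0 : ∀ y → frob 0 y ≡ y
    frob-0 = *-identityʳ

    frob-suc : ∀ i y → frob (suc i) y ≡ frob i y ^ p
    frob-suc i y = trans (cong (y ^_) (ℕ.*-comm p (p ℕ.^ i))) (sym (^-assocʳ y (p ℕ.^ i) p))

    frob-* : ∀ i x y → frob i (x * y) ≡ frob i x * frob i y
    frob-* i x y = ^-distrib-* x y (p ℕ.^ i)

    frob-+ : ∀ i x y → frob i (x + y) ≡ frob i x + frob i y
    frob-+ zero x y = trans (frob-0 _) (sym (cong₂ _+_ (frob-0 x) (frob-0 y)))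
    frob-+ (suc i) x y = begin
      frob (suc i) (x + y)              ≡⟨ frob-suc i (x + y) ⟩
      frob i (x + y) ^ p                ≡⟨ cong (_^ p) (frob-+ i x y) ⟩
      (frob i x + frob i y) ^ p         ≡⟨ frobenius-+ _ _ ⟩
      frob i x ^ p + frob i y ^ p       ≡⟨ cong₂ _+_ (frob-suc i x) (frob-suc i y) ⟨
      frob (suc i) x + frob (suc i) y   ∎

    frob-fixed : ∀ {y} → y ^ p ≡ y → ∀ i → frob i y ≡ y
    frob-fixed fix zero    = frob-0 _
    frob-fixed fix (suc i) = trans (frob-suc i _) (trans (cong (_^ p) (frob-fixed fix i)) fix)

    frob-Σ : ∀ i n f → frob i (Σ n f) ≡ Σ n (λ k → frob i (f k))
    frob-Σ i = Σ-additive (frob i) (frob-fixed (0^ p) i) (frob-+ i)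

    frob-translate : ∀ {θ} → θ ^ p ≡ θ + 1# → ∀ i → frob i θ ≡ θ + ν i
    frob-translate θᵖ zero = trans (frob-0 _) (sym (+-identityʳ _))
    frob-translate {θ} θᵖ (suc i) = begin
      frob (suc i) θ     ≡⟨ frob-suc i θ ⟩
      frob i θ ^ p       ≡⟨ cong (_^ p) (frob-translate θᵖ i) ⟩
      (θ + ν i) ^ p      ≡⟨ frobenius-+ θ (ν i) ⟩
      θ ^ p + ν i ^ p    ≡⟨ cong₂ _+_ θᵖ (frobenius-ν i) ⟩
      θ + 1# + ν i       ≡⟨ +-assoc θ 1# (ν i) ⟩
      θ + ν (suc i)      ∎

    Tr : A → A
    Tr y = Σ p (λ i → frob i y)

    Tr-0 : Tr 0# ≡ 0#
    Tr-0 = Σ-zero p λ i _ → frob-fixed (0^ p) i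

    Tr-+ : ∀ x y → Tr (x + y) ≡ Tr x + Tr y
    Tr-+ x y = trans (Σ-cong p λ i _ → frob-+ i x y) (Σ-+ p _ _)

    Tr-Σ : ∀ n f → Tr (Σ n f) ≡ Σ n (λ k → Tr (f k))
    Tr-Σ = Σ-additive Tr Tr-0 Tr-+

    Tr-* : ∀ {c} → c ^ p ≡ c → ∀ y → Tr (c * y) ≡ c * Tr y
    Tr-* {c} fix y = trans (Σ-cong p λ i _ → trans (frob-* i c y) (*-congʳ (frob-fixed fix i)))
                           (sym (Σ-*ˡ c p _))

    Tr-ν : ∀ n y → Tr (ν n * y) ≡ ν n * Tr y
    Tr-ν n = Tr-* (frobenius-ν n)

    -- Multiplication by a permutes the residues modulo p, with multiplication by b as its inverse,
    -- and periodicity makes `g` a function of residues.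
    Σ-periodic-scale : ∀ {g a b} → (∀ n → g (n ℕ.+ p) ≡ g n) → (a ℕ.* b) % p ≡ 1 →
                       Σ p (λ k → g (k ℕ.* a)) ≡ Σ p g
    Σ-periodic-scale {g} {a} {b} periodic ab≡1 = sym (begin
      Σ p g                              ≡⟨ Σ≡sum p g ⟩
      sum {p} (g ∘ toℕ)                  ≡⟨ sum-permute (g ∘ toℕ) π ⟩
      sum {p} (g ∘ toℕ ∘ times a)        ≡⟨ sum-cong-≗ {p} (λ i → trans (cong g (toℕ-times a i)) (sym (g-% (toℕ i ℕ.* a)))) ⟩
      sum {p} (λ i → g (toℕ i ℕ.* a))    ≡⟨ Σ≡sum p (λ k → g (k ℕ.* a)) ⟨
      Σ p (λ k → g (k ℕ.* a))            ∎)
      where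
      times : ℕ → Fin p → Fin p
      times c i = (toℕ i ℕ.* c) mod p
      toℕ-times : ∀ c i → toℕ (times c i) ≡ (toℕ i ℕ.* c) % p
      toℕ-times c i = toℕ-mod (toℕ i ℕ.* c)
      times-times : ∀ c d → (c ℕ.* d) % p ≡ 1 → ∀ i → times d (times c i) ≡ i
      times-times c d cd≡1 i = Fin.toℕ-injective (begin
        toℕ (times d (times c i))                   ≡⟨ toℕ-times d (times c i) ⟩
        (toℕ (times c i) ℕ.* d) % p                 ≡⟨ cong (λ x → (x ℕ.* d) % p) (toℕ-times c i) ⟩
        ((toℕ i ℕ.* c) % p ℕ.* d) % p               ≡⟨ %-distribˡ-* ((toℕ i ℕ.* c) % p) d p ⟩
        ((toℕ i ℕ.* c) % p % p ℕ.* (d % p)) % p     ≡⟨ cong (λ x → (x ℕ.* (d % p)) % p) (m%n%n≡m%n (toℕ i ℕ.* c) p) ⟩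
        ((toℕ i ℕ.* c) % p ℕ.* (d % p)) % p         ≡⟨ %-distribˡ-* (toℕ i ℕ.* c) d p ⟨
        (toℕ i ℕ.* c ℕ.* d) % p                     ≡⟨ cong (_% p) (ℕ.*-assoc (toℕ i) c d) ⟩
        (toℕ i ℕ.* (c ℕ.* d)) % p                   ≡⟨ %-distribˡ-* (toℕ i) (c ℕ.* d) p ⟩
        (toℕ i % p ℕ.* ((c ℕ.* d) % p)) % p         ≡⟨ cong (λ x → (toℕ i % p ℕ.* x) % p) cd≡1 ⟩
        (toℕ i % p ℕ.* 1) % p                       ≡⟨ cong (_% p) (ℕ.*-identityʳ _) ⟩
        toℕ i % p % p                               ≡⟨ m%n%n≡m%n (toℕ i) p ⟩
        toℕ i % p                                   ≡⟨ m<n⇒m%n≡m (Fin.toℕ<n i) ⟩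
        toℕ i                                       ∎)
      π = permutation (times a) (times b)
            (times-times b a (trans (cong (_% p) (ℕ.*-comm b a)) ab≡1)) (times-times a b ab≡1)
      g-multiple : ∀ m k → g (m ℕ.+ k ℕ.* p) ≡ g m
      g-multiple m zero    = cong g (ℕ.+-identityʳ m)
      g-multiple m (suc k) = begin
        g (m ℕ.+ (p ℕ.+ k ℕ.* p))  ≡⟨ cong (λ x → g (m ℕ.+ x)) (ℕ.+-comm p (k ℕ.* p)) ⟩
        g (m ℕ.+ (k ℕ.* p ℕ.+ p))  ≡⟨ cong g (ℕ.+-assoc m (k ℕ.* p) p) ⟨
        g (m ℕ.+ k ℕ.* p ℕ.+ p)    ≡⟨ periodic _ ⟩
        g (m ℕ.+ k ℕ.* p)          ≡⟨ g-multiple m k ⟩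
        g m                        ∎
      g-% : ∀ n → g n ≡ g (n % p)
      g-% n = trans (cong g (m≡m%n+[m/n]*n n p)) (g-multiple (n % p) (n ℕ./ p))

    -- Frobenius of order dividing p: invariance and values of the trace.

    module FiniteField (frob-p : ∀ y → frob p y ≡ y) where

      frob-periodic : ∀ y n → frob (n ℕ.+ p) y ≡ frob n y
      frob-periodic y n = trans (frob-∘ n p y) (cong (frob n) (frob-p y))

      -- A Frobenius step rotates the p summands, as `frob p` brings back `frob 0`. Adding
      -- `frob 0 y` to both sides lets the sum be extended at one end and shortened at the other.
      Tr-frob : ∀ j y → Tr (frob j y) ≡ Tr y
      Tr-frob zero    y = cong Tr (frob-0 y)
      Tr-frob (suc j) y = trans (cong Tr (frob-∘ 1 j y)) (trans (step (frob j y)) (Tr-frob j y))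
        where
        step : ∀ y → Tr (frob 1 y) ≡ Tr y
        step y = +-cancelˡ (frob 0 y) _ _ (begin
          frob 0 y + Tr (frob 1 y)
            ≡⟨ +-congˡ (Σ-cong p λ i _ → trans (sym (frob-∘ i 1 y)) (cong (λ n → frob n y) (ℕ.+-comm i 1))) ⟩
          frob 0 y + Σ p (λ i → frob (suc i) y)
            ≡⟨ Σ-head p (λ i → frob i y) ⟨
          Tr y + frob p y
            ≡⟨ trans (+-comm _ _) (+-congʳ (trans (frob-p y) (sym (frob-0 y)))) ⟩
          frob 0 y + Tr y ∎)

      -- Being fixed by Frobenius is the form in which membership in 𝔽_p is used: by `Tr-*` it lets
      -- one trace move in and out of another.
      Tr-in-prime-field : ∀ y → Tr y ^ p ≡ Tr y
      Tr-in-prime-field y = begin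
        Tr y ^ p                         ≡⟨ trans (cong (_^ p) (sym (frob-0 _))) (sym (frob-suc 0 _)) ⟩
        frob 1 (Tr y)                    ≡⟨ frob-Σ 1 p _ ⟩
        Σ p (λ i → frob 1 (frob i y))
          ≡⟨ Σ-cong p (λ i _ → trans (sym (frob-∘ 1 i y)) (trans (cong (λ n → frob n y) (ℕ.+-comm 1 i)) (frob-∘ i 1 y))) ⟩
        Tr (frob 1 y)                    ≡⟨ Tr-frob 1 y ⟩
        Tr y                             ∎

      -- As a is prime to p, the iterates of ψ = `frob a` run through the same p conjugates, so the
      -- trace becomes a sum along the orbit of ψ.
      Tr-scale : ∀ {a b} → (a ℕ.* b) % p ≡ 1 → ∀ y → Σ p (λ k → frob (k ℕ.* a) y) ≡ Tr y
      Tr-scale ab≡1 y = Σ-periodic-scale (frob-periodic y) ab≡1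

      -- The Artin-Schreier element θ and its products of conjugates.

      module ArtinSchreier {θ : A} (θᵖ : θ ^ p ≡ θ + 1#) {a b : ℕ} (ab≡1 : (a ℕ.* b) % p ≡ 1) where

        private
          α ξ : A
          α = ν a
          ξ = ν b

          -- `E k` is the product of θ, ψ(θ), ..., ψ^(k-1)(θ) with ψ = `frob a`, and `e k` is the
          -- analogous product along the inverse of ψ.
          E e : ℕ → A
          E k = rise k θ α
          e k = rise k θ (- α)

        αξ≡1 : α * ξ ≡ 1#
        αξ≡1 = begin
          α * ξ                                     ≡⟨ ν-* a b ⟨
          ν (a ℕ.* b)                               ≡⟨ cong ν (m≡m%n+[m/n]*n (a ℕ.* b) p) ⟩
          ν ((a ℕ.* b) % p ℕ.+ (a ℕ.* b) ℕ./ p ℕ.* p)  ≡⟨ cong (λ x → ν (x ℕ.+ (a ℕ.* b) ℕ./ p ℕ.* p)) ab≡1 ⟩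
          1# + ν ((a ℕ.* b) ℕ./ p ℕ.* p)            ≡⟨ +-congˡ (∣⇒×≡0 {p} νp≡0 (divides ((a ℕ.* b) ℕ./ p) refl) 1#) ⟩
          1# + 0#                                   ≡⟨ +-identityʳ 1# ⟩
          1#                                        ∎

        frob-ka : ∀ k → frob (k ℕ.* a) θ ≡ θ + ν k * α
        frob-ka k = trans (frob-translate θᵖ (k ℕ.* a)) (+-congˡ (ν-* k a))

        frob-a : ∀ β k → frob a (θ + ν k * β) ≡ θ + α + frob a (ν k * β)
        frob-a β k = trans (frob-+ a θ _) (+-congʳ (frob-translate θᵖ a))

        frob-a-step : ∀ k → frob a (θ + ν k * α) ≡ θ + ν (suc k) * α
        frob-a-step k = begin
          frob a (θ + ν k * α)           ≡⟨ frob-a α k ⟩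
          θ + α + frob a (ν k * α)
            ≡⟨ +-congˡ (frob-fixed (trans (^-distrib-* (ν k) α p) (cong₂ _*_ (frobenius-ν k) (frobenius-ν a))) a) ⟩
          θ + α + ν k * α                ≡⟨ solve 3 (λ θ α k → θ :+ α :+ k :* α := θ :+ (con 1 :+ k) :* α) refl θ α (ν k) ⟩
          θ + ν (suc k) * α              ∎

        -- ψ moves every factor to the next one, and θ fills the gap at the front.
        frob-a-E : ∀ k → θ * frob a (E k) ≡ E (suc k)
        frob-a-E zero = begin
          θ * frob a 1#            ≡⟨ *-congˡ (1^ (p ℕ.^ a)) ⟩
          θ * 1#                   ≡⟨ *-comm θ 1# ⟩
          1# * θ                   ≡⟨ *-congˡ (trans (+-congˡ (zeroˡ α)) (+-identityʳ θ)) ⟨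
          1# * (θ + 0# * α)        ∎
        frob-a-E (suc k) = begin
          θ * frob a (E k * (θ + ν k * α))             ≡⟨ *-congˡ (frob-* a _ _) ⟩
          θ * (frob a (E k) * frob a (θ + ν k * α))    ≡⟨ *-assoc _ _ _ ⟨
          θ * frob a (E k) * frob a (θ + ν k * α)      ≡⟨ cong₂ _*_ (frob-a-E k) (frob-a-step k) ⟩
          E (suc k) * (θ + ν (suc k) * α)              ∎

        neg-αξ≡1 : - α * - ξ ≡ 1#
        neg-αξ≡1 = begin
          - α * - ξ      ≡⟨ -‿distribˡ-* α (- ξ) ⟨
          - (α * - ξ)    ≡⟨ cong -_ (-‿distribʳ-* α ξ) ⟨
          - - (α * ξ)    ≡⟨ -‿involutive _ ⟩
          α * ξ          ≡⟨ αξ≡1 ⟩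
          1#             ∎

        neg-αᵖ : (- α) ^ p ≡ - α
        neg-αᵖ = trans (frobenius-neg α) (cong -_ (frobenius-ν a))

        E-1 : E 1 ≡ θ
        E-1 = trans (*-identityˡ _) (trans (+-congˡ (zeroˡ α)) (+-identityʳ θ))

        -- `E p` is the norm of θ: the two-term Stirling expansion reads θ^p = θ + `E p`, to be
        -- compared with θ^p = θ + 1.
        E-p : E p ≡ 1#
        E-p = +-cancelˡ θ _ _ (sym (begin
          θ + 1#                ≡⟨ θᵖ ⟨
          θ ^ p                 ≡⟨ *-identityʳ _ ⟨
          θ ^ p * 1#
            ≡⟨ stirling-frobenius neg-αξ≡1 neg-αᵖ (λ n k → θ ^ n * E k) (rise-recurrence (-‿inverseˡ α) θ) ⟩
          1# * E 1 + 1# * E p   ≡⟨ cong₂ _+_ (trans (*-identityˡ _) E-1) (*-identityˡ _) ⟩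
          θ + E p               ∎))

        private
          -- The other p - 1 conjugates ψ(θ), ..., ψ^(p-1)(θ) multiply to 1/θ, because the norm is
          -- 1.
          v : A
          v = frob a (E (ℕ.pred p))

        θv≡1 : θ * v ≡ 1#
        θv≡1 = trans (frob-a-E (ℕ.pred p)) (trans (cong E (ℕ.suc-pred p)) E-p)

        -- With σ the logarithmic derivative of E, the terms θⁿ E (n / θ + σ) are the
        -- derivatives of the terms θⁿ E, and differentiating yields Σ 1/(θ + i) = -1.
        Tr-v : 1# + Tr v ≡ 0#
        Tr-v = sym (begin
          0#
            -- The derivative of θ^p carries the factor p, and `σ 0` is the empty sum, so the left
            -- side of the differentiated identity is 0.
            ≡⟨ trans (*-congˡ (trans (+-congʳ (trans (*-congʳ νp≡0) (zeroˡ v))) (+-identityʳ 0#))) (zeroʳ _) ⟨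
          q p 0
            ≡⟨ stirling-frobenius neg-αξ≡1 neg-αᵖ q q-rec ⟩
          q 0 1 + q 0 p
            ≡⟨ cong₂ _+_ (q0≡ 1) (q0≡ p) ⟩
          E 1 * σ 1 + E p * σ p
            ≡⟨ cong₂ _+_ (cong₂ _*_ E-1 (trans (+-identityˡ _) (frob-0 v))) (*-congʳ E-p) ⟩
          θ * v + 1# * σ p
            ≡⟨ cong₂ _+_ θv≡1 (trans (*-identityˡ _) (Tr-scale ab≡1 v)) ⟩
          1# + Tr v ∎)
          where
          σ : ℕ → A
          σ k = Σ k (λ i → frob (i ℕ.* a) v)
          q : ℕ → ℕ → A
          q n k = θ ^ n * E k * (ν n * v + σ k)
          q0≡ : ∀ k → q 0 k ≡ E k * σ k
          q0≡ k = cong₂ _*_ (*-identityˡ _) (trans (+-congʳ (zeroˡ v)) (+-identityˡ _))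
          inverse : ∀ k → (θ + ν k * α) * frob (k ℕ.* a) v ≡ 1#
          inverse k = begin
            (θ + ν k * α) * frob (k ℕ.* a) v           ≡⟨ *-congʳ (frob-ka k) ⟨
            frob (k ℕ.* a) θ * frob (k ℕ.* a) v        ≡⟨ frob-* (k ℕ.* a) θ v ⟨
            frob (k ℕ.* a) (θ * v)                     ≡⟨ cong (frob (k ℕ.* a)) θv≡1 ⟩
            frob (k ℕ.* a) 1#                          ≡⟨ 1^ (p ℕ.^ (k ℕ.* a)) ⟩
            1#                                         ∎
          q-rec : ∀ n k → q (suc n) k ≡ q n (suc k) + ν k * (- α * q n k)
          q-rec n k = sym (begin
            q n (suc k) + ν k * (- α * q n k)
              ≡⟨⟩
            θ ^ n * (E k * (θ + ν k * α)) * (ν n * v + (σ k + w)) + ν k * (- α * (θ ^ n * E k * (ν n * v + σ k)))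
              ≡⟨ solve 10 (λ t E θ k α β n v σ w →
                   t :* (E :* (θ :+ k :* α)) :* (n :* v :+ (σ :+ w)) :+ k :* (β :* (t :* E :* (n :* v :+ σ)))
                   := t :* E :* (θ :* (n :* v :+ σ)) :+ t :* E :* ((θ :+ k :* α) :* w) :+ k :* (t :* E :* (n :* v :+ σ)) :* (β :+ α))
                   refl (θ ^ n) (E k) θ (ν k) α (- α) (ν n) v (σ k) w ⟩
            θ ^ n * E k * (θ * (ν n * v + σ k)) + θ ^ n * E k * ((θ + ν k * α) * w) + ν k * (θ ^ n * E k * (ν n * v + σ k)) * (- α + α)
              -- The extra factor has derivative 1 on either side: it appears as (θ + kα) w in
              -- `q n (suc k)` and as θ v in `q (suc n) k`.
              ≡⟨ cong₂ _+_ (+-congˡ (*-congˡ (trans (inverse k) (sym θv≡1)))) (trans (*-congˡ (-‿inverseˡ α)) (zeroʳ _)) ⟩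
            θ ^ n * E k * (θ * (ν n * v + σ k)) + θ ^ n * E k * (θ * v) + 0#
              ≡⟨ +-identityʳ _ ⟩
            θ ^ n * E k * (θ * (ν n * v + σ k)) + θ ^ n * E k * (θ * v)
              ≡⟨ solve 6 (λ t E θ n v σ → t :* E :* (θ :* (n :* v :+ σ)) :+ t :* E :* (θ :* v)
                   := θ :* t :* E :* (v :+ n :* v :+ σ)) refl (θ ^ n) (E k) θ (ν n) v (σ k) ⟩
            θ * θ ^ n * E k * (v + ν n * v + σ k)
              ≡⟨ cong (λ x → θ * θ ^ n * E k * (x + σ k)) (trans (distribʳ v 1# (ν n)) (+-congʳ (*-identityˡ v))) ⟨
            q (suc n) k ∎)
            where w = frob (k ℕ.* a) v

        -- Applying ψ to `E (suc k)` trades its factor θ for θ + (k+1)α, a change of (k+1)α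
        -- ψ(`E k`). The trace does not see ψ, so this change has trace 0, and (k+1)α is a unit as
        -- long as k+1 < p.
        Tr-E≡0 : ∀ k → suc k < p → Tr (E k) ≡ 0#
        Tr-E≡0 k k<p = begin
          Tr (E k)               ≡⟨ *-identityˡ _ ⟨
          1# * Tr (E k)          ≡⟨ *-congʳ (trans (*-comm ξ α) αξ≡1) ⟨
          ξ * α * Tr (E k)       ≡⟨ *-assoc ξ α _ ⟩
          ξ * (α * Tr (E k))     ≡⟨ *-congˡ (ν-cancelˡ (s≤s z≤n) k<p (+-cancelˡ (Tr (E (suc k))) _ _ difference)) ⟩
          ξ * 0#                 ≡⟨ zeroʳ ξ ⟩
          0#                     ∎
          where
          ψE = frob a (E k)
          expand : frob a (E (suc k)) ≡ E (suc k) + ν (suc k) * (α * ψE)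
          expand = begin
            frob a (E k * (θ + ν k * α))      ≡⟨ frob-* a _ _ ⟩
            ψE * frob a (θ + ν k * α)         ≡⟨ *-congˡ (frob-a-step k) ⟩
            ψE * (θ + ν (suc k) * α)
              ≡⟨ solve 4 (λ ψE θ k α → ψE :* (θ :+ k :* α) := θ :* ψE :+ k :* (α :* ψE)) refl ψE θ (ν (suc k)) α ⟩
            θ * ψE + ν (suc k) * (α * ψE)     ≡⟨ +-congʳ (frob-a-E k) ⟩
            E (suc k) + ν (suc k) * (α * ψE)  ∎
          difference : Tr (E (suc k)) + ν (suc k) * (α * Tr (E k)) ≡ Tr (E (suc k)) + 0#
          difference = begin
            Tr (E (suc k)) + ν (suc k) * (α * Tr (E k))
              ≡⟨ +-congˡ (*-congˡ (*-congˡ (Tr-frob a (E k)))) ⟨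
            Tr (E (suc k)) + ν (suc k) * (α * Tr ψE)
              ≡⟨ +-congˡ (*-congˡ (Tr-ν a ψE)) ⟨
            Tr (E (suc k)) + ν (suc k) * Tr (α * ψE)
              ≡⟨ +-congˡ (Tr-ν (suc k) (α * ψE)) ⟨
            Tr (E (suc k)) + Tr (ν (suc k) * (α * ψE))
              ≡⟨ Tr-+ _ _ ⟨
            Tr (E (suc k) + ν (suc k) * (α * ψE))
              ≡⟨ cong Tr expand ⟨
            Tr (frob a (E (suc k)))
              ≡⟨ Tr-frob a _ ⟩
            Tr (E (suc k))
              ≡⟨ +-identityʳ _ ⟨
            Tr (E (suc k)) + 0# ∎

        private
          t : A
          t = θ ^ τ p a

        -- ψ adds α to each factor, which moves the product back by one index and puts θ + α in
        -- front.
        frob-a-e : ∀ k → frob a (e (suc k)) ≡ (θ + α) * e k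
        frob-a-e zero = begin
          frob a (1# * (θ + 0# * - α))
            ≡⟨ cong (frob a) (trans (*-identityˡ _) (trans (+-congˡ (zeroˡ _)) (+-identityʳ θ))) ⟩
          frob a θ                       ≡⟨ frob-translate θᵖ a ⟩
          θ + α                          ≡⟨ *-identityʳ _ ⟨
          (θ + α) * 1#                   ∎
        frob-a-e (suc k) = begin
          frob a (e (suc k) * (θ + ν (suc k) * - α))
            ≡⟨ trans (frob-* a _ _) (cong₂ _*_ (frob-a-e k) (frob-a (- α) (suc k))) ⟩
          (θ + α) * e k * (θ + α + frob a (ν (suc k) * - α))
            ≡⟨ *-congˡ (+-congˡ (frob-fixed (trans (^-distrib-* _ _ p) (cong₂ _*_ (frobenius-ν (suc k)) neg-αᵖ)) a)) ⟩
          (θ + α) * e k * (θ + α + (1# + ν k) * - α)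
            ≡⟨ solve 5 (λ θ α β e k → (θ :+ α) :* e :* (θ :+ α :+ (con 1 :+ k) :* β)
                 := (θ :+ α) :* (e :* (θ :+ k :* β :+ (α :+ β)))) refl θ α (- α) (e k) (ν k) ⟩
          (θ + α) * (e k * (θ + ν k * - α + (α + - α)))
            ≡⟨ *-congˡ (*-congˡ (trans (+-congˡ (-‿inverseʳ α)) (+-identityʳ _))) ⟩
          (θ + α) * e (suc k) ∎

        -- Since τ p a * p^a + Σ_{j<p} p^(ja+a-1) = τ p a + p^(pa), raising θ to these powers
        -- and using that θ has norm 1 gives θ^(τ p a * p^a) = θ^(τ p a) * θ.
        frob-a-θ^τ : frob a t ≡ t * θ
        frob-a-θ^τ = go a refl
          where
          -- Here `c` is a - 1, which writes the exponents ja + a - 1 without subtraction; θ to the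
          -- power p^(ja+c) is the c-th Frobenius iterate of ψ^j(θ).
          product : ∀ c n → a ≡ suc c → θ ^ sumN n (λ j → p ℕ.^ (j ℕ.* a ℕ.+ c)) ≡ frob c (E n)
          product c zero    _    = sym (1^ (p ℕ.^ c))
          product c (suc n) a≡1+c = begin
            θ ^ (s ℕ.+ p ℕ.^ (n ℕ.* a ℕ.+ c))
              ≡⟨ ^-homo-* θ s (p ℕ.^ (n ℕ.* a ℕ.+ c)) ⟩
            θ ^ s * frob (n ℕ.* a ℕ.+ c) θ
              ≡⟨ cong₂ _*_ (product c n a≡1+c) (cong (λ i → frob i θ) (ℕ.+-comm (n ℕ.* a) c)) ⟩
            frob c (E n) * frob (c ℕ.+ n ℕ.* a) θ
              ≡⟨ *-congˡ (trans (frob-∘ c (n ℕ.* a) θ) (cong (frob c) (frob-ka n))) ⟩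
            frob c (E n) * frob c (θ + ν n * α)
              ≡⟨ frob-* c _ _ ⟨
            frob c (E (suc n)) ∎
            where s = sumN n (λ j → p ℕ.^ (j ℕ.* a ℕ.+ c))
          go : ∀ a′ → a ≡ a′ → frob a t ≡ t * θ
          go zero a≡0 = ⊥-elim (0≢1 (trans (sym (cong (_% p) (cong (ℕ._* b) a≡0))) ab≡1))
            where
            0≢1 : 0 % p ≢ 1
            0≢1 0≡1 with () ← trans (sym (m<n⇒m%n≡m (ℕ.>-nonZero⁻¹ p))) 0≡1
          go (suc c) a≡1+c = begin
            frob a t
              ≡⟨ ^-assocʳ θ (τ p a) (p ℕ.^ a) ⟩
            θ ^ (τ p a ℕ.* p ℕ.^ a)
              ≡⟨ *-identityʳ _ ⟨
            θ ^ (τ p a ℕ.* p ℕ.^ a) * 1#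
              ≡⟨ *-congˡ (trans (product c p a≡1+c) (trans (cong (frob c) E-p) (1^ (p ℕ.^ c)))) ⟨
            θ ^ (τ p a ℕ.* p ℕ.^ a) * θ ^ sumN p (λ j → p ℕ.^ (j ℕ.* a ℕ.+ c))
              ≡⟨ ^-homo-* θ (τ p a ℕ.* p ℕ.^ a) _ ⟨
            θ ^ (τ p a ℕ.* p ℕ.^ a ℕ.+ sumN p (λ j → p ℕ.^ (j ℕ.* a ℕ.+ c)))
              ≡⟨ cong (θ ^_) (subst (λ a → τ p a ℕ.* p ℕ.^ a ℕ.+ sumN p (λ j → p ℕ.^ (j ℕ.* a ℕ.+ c)) ≡ τ p a ℕ.+ p ℕ.^ (p ℕ.* a))
                   (sym a≡1+c) (τ-shift p c)) ⟩
            θ ^ (τ p a ℕ.+ p ℕ.^ (p ℕ.* a))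
              ≡⟨ ^-homo-* θ (τ p a) (p ℕ.^ (p ℕ.* a)) ⟩
            t * frob (p ℕ.* a) θ
              ≡⟨ *-congˡ (trans (frob-ka p) (trans (+-congˡ (trans (*-congʳ νp≡0) (zeroˡ α))) (+-identityʳ θ))) ⟩
            t * θ ∎

        -- From ψ^(k+1)(t) = ψ^k(t) ψ^k(θ) the conjugates of θ accumulate to `E k`.
        frob-ka-θ^τ : ∀ k → frob (k ℕ.* a) t ≡ E k * t
        frob-ka-θ^τ zero    = trans (frob-0 t) (sym (*-identityˡ t))
        frob-ka-θ^τ (suc k) = begin
          frob (a ℕ.+ k ℕ.* a) t                    ≡⟨ cong (λ i → frob i t) (ℕ.+-comm a (k ℕ.* a)) ⟩
          frob (k ℕ.* a ℕ.+ a) t                    ≡⟨ frob-∘ (k ℕ.* a) a t ⟩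
          frob (k ℕ.* a) (frob a t)                 ≡⟨ cong (frob (k ℕ.* a)) frob-a-θ^τ ⟩
          frob (k ℕ.* a) (t * θ)                    ≡⟨ frob-* (k ℕ.* a) t θ ⟩
          frob (k ℕ.* a) t * frob (k ℕ.* a) θ       ≡⟨ cong₂ _*_ (frob-ka-θ^τ k) (frob-ka k) ⟩
          E k * t * (θ + ν k * α)
            ≡⟨ solve 3 (λ E t x → E :* t :* x := E :* x :* t) refl (E k) t (θ + ν k * α) ⟩
          E (suc k) * t                             ∎

        module _ {u : A} (uθt≡1 : u * (θ * t) ≡ 1#) where

          tu≡v : t * u ≡ v
          tu≡v = begin
            t * u                ≡⟨ *-identityˡ _ ⟨
            1# * (t * u)         ≡⟨ *-congʳ θv≡1 ⟨
            θ * v * (t * u)      ≡⟨ solve 4 (λ θ v t u → θ :* v :* (t :* u) := v :* (u :* (θ :* t))) refl θ v t u ⟩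
            v * (u * (θ * t))    ≡⟨ *-congˡ uθt≡1 ⟩
            v * 1#               ≡⟨ *-identityʳ v ⟩
            v                    ∎

          -- `Tr t` is fixed by Frobenius and moves inside the other trace; along the orbit of ψ it
          -- is the sum of the `E k * t`, and t u = 1/θ.
          Tr-t*Tr-u : Tr t * Tr u ≡ Tr v
          Tr-t*Tr-u = begin
            Tr t * Tr u                              ≡⟨ Tr-* (Tr-in-prime-field t) u ⟨
            Tr (Tr t * u)                            ≡⟨ cong (λ x → Tr (x * u)) (Tr-scale ab≡1 t) ⟨
            Tr (Σ p (λ k → frob (k ℕ.* a) t) * u)    ≡⟨ cong Tr (Σ-*ʳ u p _) ⟩
            Tr (Σ p (λ k → frob (k ℕ.* a) t * u))
              ≡⟨ cong Tr (Σ-cong p λ k _ → trans (*-congʳ (frob-ka-θ^τ k)) (trans (*-assoc _ t u) (*-congˡ tu≡v))) ⟩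
            Tr (Σ p (λ k → E k * v))                 ≡⟨ Tr-Σ p _ ⟩
            Σ p (λ k → Tr (E k * v))                 ≡⟨ Σ-single p _ (ℕ.>-nonZero⁻¹ p) off ⟩
            Tr (1# * v)                              ≡⟨ cong Tr (*-identityˡ v) ⟩
            Tr v                                     ∎
            where
            off : ∀ k → k < p → k ≢ 0 → Tr (E k * v) ≡ 0#
            off zero    _   0≢0 = ⊥-elim (0≢0 refl)
            -- The leading θ of `E (suc k)` cancels against v and leaves ψ(`E k`), whose trace
            -- vanishes; so every index from 1 to p - 1 drops out.
            off (suc k) k<p _   = begin
              Tr (E (suc k) * v)            ≡⟨ cong (λ x → Tr (x * v)) (frob-a-E k) ⟨
              Tr (θ * frob a (E k) * v)
                ≡⟨ cong Tr (solve 3 (λ θ x v → θ :* x :* v := x :* (θ :* v)) refl θ (frob a (E k)) v) ⟩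
              Tr (frob a (E k) * (θ * v))   ≡⟨ cong Tr (trans (*-congˡ θv≡1) (*-identityʳ _)) ⟩
              Tr (frob a (E k))             ≡⟨ Tr-frob a (E k) ⟩
              Tr (E k)                      ≡⟨ Tr-E≡0 k k<p ⟩
              0#                            ∎

          -- ψ sends θ to θ + α and t to tθ, hence multiplies θt by θ + α and its inverse u by the
          -- inverse of that.
          frob-a-u : (θ + α) * frob a u ≡ u
          frob-a-u = begin
            (θ + α) * frob a u                           ≡⟨ *-identityʳ _ ⟨
            (θ + α) * frob a u * 1#                      ≡⟨ *-congˡ uθt≡1 ⟨
            (θ + α) * frob a u * (u * (θ * t))
              ≡⟨ solve 5 (λ x ψ u θ t → x :* ψ :* (u :* (θ :* t)) := u :* (ψ :* (x :* (t :* θ))))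
                   refl (θ + α) (frob a u) u θ t ⟩
            u * (frob a u * ((θ + α) * (t * θ)))         ≡⟨ *-congˡ (*-congˡ (cong₂ _*_ (frob-translate θᵖ a) frob-a-θ^τ)) ⟨
            u * (frob a u * (frob a θ * frob a t))       ≡⟨ *-congˡ (trans (frob-* a u _) (*-congˡ (frob-* a θ t))) ⟨
            u * frob a (u * (θ * t))                     ≡⟨ *-congˡ (trans (cong (frob a) uθt≡1) (1^ (p ℕ.^ a))) ⟩
            u * 1#                                       ≡⟨ *-identityʳ u ⟩
            u                                            ∎

          -- The factor θ + α that ψ produces from `e (suc k)` is the one that turns ψ(u) back into
          -- u, so `e (suc k) * u` and `e k * u` are conjugate.
          Tr-e*u : ∀ k → Tr (e k * u) ≡ Tr u
          Tr-e*u zero    = cong Tr (*-identityˡ u)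
          Tr-e*u (suc k) = begin
            Tr (e (suc k) * u)                   ≡⟨ Tr-frob a _ ⟨
            Tr (frob a (e (suc k) * u))          ≡⟨ cong Tr (trans (frob-* a _ u) (*-congʳ (frob-a-e k))) ⟩
            Tr ((θ + α) * e k * frob a u)
              ≡⟨ cong Tr (solve 3 (λ x e ψ → x :* e :* ψ := e :* (x :* ψ)) refl (θ + α) (e k) (frob a u)) ⟩
            Tr (e k * ((θ + α) * frob a u))      ≡⟨ cong (λ x → Tr (e k * x)) frob-a-u ⟩
            Tr (e k * u)                         ≡⟨ Tr-e*u k ⟩
            Tr u                                 ∎

          -- With the traces themselves as the family q, the Stirling expansion ends in the values
          -- `Tr (e k * u)`, which all agree.
          Tr-θⁿ*u : ∀ n N → n < N → Tr (θ ^ n * u) ≡ Σ N (λ k → ν (S n k) * (α ^ n * ξ ^ k)) * Tr u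
          Tr-θⁿ*u n N n<N = begin
            Tr (θ ^ n * u)           ≡⟨ cong (λ x → Tr (x * u)) (*-identityʳ (θ ^ n)) ⟨
            q n 0                    ≡⟨ cong (λ n → q n 0) (ℕ.+-identityʳ n) ⟨
            q (n ℕ.+ 0) 0            ≡⟨ stirling-expansion αξ≡1 q q-rec n 0 N n<N ⟩
            Σ N (λ k → ν (S n k) * (α ^ n * ξ ^ k * q 0 k))
              ≡⟨ Σ-cong N (λ k _ → trans (*-congˡ (*-congˡ (trans (cong (λ x → Tr (x * u)) (*-identityˡ (e k))) (Tr-e*u k))))
                   (sym (*-assoc _ _ _))) ⟩
            Σ N (λ k → ν (S n k) * (α ^ n * ξ ^ k) * Tr u)
              ≡⟨ Σ-*ʳ (Tr u) N _ ⟨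
            Σ N (λ k → ν (S n k) * (α ^ n * ξ ^ k)) * Tr u ∎
            where
            q : ℕ → ℕ → A
            q n k = Tr (θ ^ n * e k * u)
            q-rec : ∀ n k → q (suc n) k ≡ q n (suc k) + ν k * (α * q n k)
            q-rec n k = begin
              q (suc n) k
                ≡⟨ cong (λ x → Tr (x * u)) (rise-recurrence (-‿inverseʳ α) θ n k) ⟩
              Tr ((θ ^ n * e (suc k) + ν k * (α * (θ ^ n * e k))) * u)
                ≡⟨ cong Tr (solve 5 (λ x k α y u → (x :+ k :* (α :* y)) :* u := x :* u :+ k :* (α :* (y :* u))) refl
                     (θ ^ n * e (suc k)) (ν k) α (θ ^ n * e k) u) ⟩
              Tr (θ ^ n * e (suc k) * u + ν k * (α * (θ ^ n * e k * u)))
                ≡⟨ Tr-+ _ _ ⟩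
              q n (suc k) + Tr (ν k * (α * (θ ^ n * e k * u)))
                ≡⟨ +-congˡ (trans (Tr-ν k _) (*-congˡ (Tr-ν a _))) ⟩
              q n (suc k) + ν k * (α * q n k) ∎

          trace-formula : ∀ n N → n < N → - Tr t * Tr (θ ^ n * u) ≡ Σ N (λ k → ν (S n k) * (α ^ n * ξ ^ k))
          trace-formula n N n<N = begin
            - Tr t * Tr (θ ^ n * u)    ≡⟨ *-congˡ (Tr-θⁿ*u n N n<N) ⟩
            - Tr t * (s * Tr u)        ≡⟨ solve 3 (λ x s y → x :* (s :* y) := s :* (x :* y)) refl (- Tr t) s (Tr u) ⟩
            s * (- Tr t * Tr u)        ≡⟨ *-congˡ (-‿distribˡ-* (Tr t) (Tr u)) ⟨
            s * - (Tr t * Tr u)        ≡⟨ *-congˡ (cong -_ Tr-t*Tr-u) ⟩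
            s * - Tr v
              ≡⟨ *-congˡ (+-cancelˡ (Tr v) _ _ (trans (-‿inverseʳ (Tr v)) (trans (sym Tr-v) (+-comm 1# (Tr v))))) ⟩
            s * 1#                     ≡⟨ *-identityʳ s ⟩
            s                          ∎
            where s = Σ N (λ k → ν (S n k) * (α ^ n * ξ ^ k))

-- The quotient 𝔽_p[x]/(x^p - x - 1) as a commutative ring.

module QuotientRing (r : ℕ) where

  -- Writing p as r + 2 lets the coefficients of 1 and x, the two that `redF` fills, be reached by
  -- computation.
  p : ℕ
  p = suc (suc r)

  open Field p renaming (Tr to TrF)

  ι-cong-% : ∀ m n → m % p ≡ n % p → ι m ≡ ι n
  ι-cong-% m n eq = Fin.toℕ-injective (trans (toℕ-mod m) (trans eq (sym (toℕ-mod n))))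

  ι-toℕ : ∀ x → ι (toℕ x) ≡ x
  ι-toℕ x = Fin.toℕ-injective (trans (toℕ-mod (toℕ x)) (m<n⇒m%n≡m (Fin.toℕ<n x)))

  ι-+ₚ : ∀ m x → ι m +ₚ x ≡ ι (m ℕ.+ toℕ x)
  ι-+ₚ m x = ι-cong-% (toℕ (ι m) ℕ.+ toℕ x) (m ℕ.+ toℕ x) (begin
    (toℕ (ι m) ℕ.+ toℕ x) % p            ≡⟨ cong (λ y → (y ℕ.+ toℕ x) % p) (toℕ-mod m) ⟩
    (m % p ℕ.+ toℕ x) % p                ≡⟨ %-distribˡ-+ (m % p) (toℕ x) p ⟩
    (m % p % p ℕ.+ toℕ x % p) % p        ≡⟨ cong (λ y → (y ℕ.+ toℕ x % p) % p) (m%n%n≡m%n m p) ⟩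
    (m % p ℕ.+ toℕ x % p) % p            ≡⟨ %-distribˡ-+ m (toℕ x) p ⟨
    (m ℕ.+ toℕ x) % p                    ∎)

  ι-*ₚ : ∀ m x → ι m *ₚ x ≡ ι (m ℕ.* toℕ x)
  ι-*ₚ m x = ι-cong-% (toℕ (ι m) ℕ.* toℕ x) (m ℕ.* toℕ x) (begin
    (toℕ (ι m) ℕ.* toℕ x) % p            ≡⟨ cong (λ y → (y ℕ.* toℕ x) % p) (toℕ-mod m) ⟩
    (m % p ℕ.* toℕ x) % p                ≡⟨ %-distribˡ-* (m % p) (toℕ x) p ⟩
    (m % p % p ℕ.* (toℕ x % p)) % p      ≡⟨ cong (λ y → (y ℕ.* (toℕ x % p)) % p) (m%n%n≡m%n m p) ⟩
    (m % p ℕ.* (toℕ x % p)) % p          ≡⟨ %-distribˡ-* m (toℕ x) p ⟨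
    (m ℕ.* toℕ x) % p                    ∎)

  +ₚ-comm : ∀ x y → x +ₚ y ≡ y +ₚ x
  +ₚ-comm x y = cong ι (ℕ.+-comm (toℕ x) (toℕ y))

  *ₚ-comm : ∀ x y → x *ₚ y ≡ y *ₚ x
  *ₚ-comm x y = cong ι (ℕ.*-comm (toℕ x) (toℕ y))

  +ₚ-ι : ∀ x m → x +ₚ ι m ≡ ι (toℕ x ℕ.+ m)
  +ₚ-ι x m = trans (+ₚ-comm x (ι m)) (trans (ι-+ₚ m x) (cong ι (ℕ.+-comm m (toℕ x))))

  *ₚ-ι : ∀ x m → x *ₚ ι m ≡ ι (toℕ x ℕ.* m)
  *ₚ-ι x m = trans (*ₚ-comm x (ι m)) (trans (ι-*ₚ m x) (cong ι (ℕ.*-comm m (toℕ x))))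

  ι-homo-+ : ∀ m n → ι (m ℕ.+ n) ≡ ι m +ₚ ι n
  ι-homo-+ m n = ι-cong-% (m ℕ.+ n) (toℕ (ι m) ℕ.+ toℕ (ι n)) (trans (%-distribˡ-+ m n p)
    (cong₂ (λ x y → (x ℕ.+ y) % p) (sym (toℕ-mod m)) (sym (toℕ-mod n))))

  +ₚ-assoc : ∀ x y z → (x +ₚ y) +ₚ z ≡ x +ₚ (y +ₚ z)
  +ₚ-assoc x y z = trans (ι-+ₚ (toℕ x ℕ.+ toℕ y) z)
    (trans (cong ι (ℕ.+-assoc (toℕ x) (toℕ y) (toℕ z))) (sym (+ₚ-ι x (toℕ y ℕ.+ toℕ z))))

  *ₚ-assoc : ∀ x y z → (x *ₚ y) *ₚ z ≡ x *ₚ (y *ₚ z)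
  *ₚ-assoc x y z = trans (ι-*ₚ (toℕ x ℕ.* toℕ y) z)
    (trans (cong ι (ℕ.*-assoc (toℕ x) (toℕ y) (toℕ z))) (sym (*ₚ-ι x (toℕ y ℕ.* toℕ z))))

  +ₚ-identityˡ : ∀ x → ι 0 +ₚ x ≡ x
  +ₚ-identityˡ x = trans (ι-+ₚ 0 x) (ι-toℕ x)

  +ₚ-identityʳ : ∀ x → x +ₚ ι 0 ≡ x
  +ₚ-identityʳ x = trans (+ₚ-comm x (ι 0)) (+ₚ-identityˡ x)

  *ₚ-identityˡ : ∀ x → ι 1 *ₚ x ≡ x
  *ₚ-identityˡ x = trans (ι-*ₚ 1 x) (trans (cong ι (ℕ.*-identityˡ (toℕ x))) (ι-toℕ x))

  *ₚ-identityʳ : ∀ x → x *ₚ ι 1 ≡ x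
  *ₚ-identityʳ x = trans (*ₚ-comm x (ι 1)) (*ₚ-identityˡ x)

  *ₚ-zeroˡ : ∀ x → ι 0 *ₚ x ≡ ι 0
  *ₚ-zeroˡ x = ι-*ₚ 0 x

  *ₚ-zeroʳ : ∀ x → x *ₚ ι 0 ≡ ι 0
  *ₚ-zeroʳ x = trans (*ₚ-comm x (ι 0)) (*ₚ-zeroˡ x)

  ι-p : ι p ≡ ι 0
  ι-p = ι-cong-% p 0 (n%n≡0 p)

  +ₚ-inverseʳ : ∀ x → x +ₚ negₚ x ≡ ι 0
  +ₚ-inverseʳ x = trans (+ₚ-ι x (p ∸ toℕ x))
    (trans (cong ι (ℕ.m+[n∸m]≡n (ℕ.<⇒≤ (Fin.toℕ<n x)))) ι-p)

  +ₚ-inverseˡ : ∀ x → negₚ x +ₚ x ≡ ι 0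
  +ₚ-inverseˡ x = trans (+ₚ-comm (negₚ x) x) (+ₚ-inverseʳ x)

  *ₚ-distribˡ-+ₚ : ∀ x y z → x *ₚ (y +ₚ z) ≡ (x *ₚ y) +ₚ (x *ₚ z)
  *ₚ-distribˡ-+ₚ x y z = trans (*ₚ-ι x (toℕ y ℕ.+ toℕ z))
    (trans (cong ι (ℕ.*-distribˡ-+ (toℕ x) (toℕ y) (toℕ z))) (ι-homo-+ (toℕ x ℕ.* toℕ y) (toℕ x ℕ.* toℕ z)))

  *ₚ-distribʳ-+ₚ : ∀ x y z → (y +ₚ z) *ₚ x ≡ (y *ₚ x) +ₚ (z *ₚ x)
  *ₚ-distribʳ-+ₚ x y z = trans (*ₚ-comm (y +ₚ z) x)
    (trans (*ₚ-distribˡ-+ₚ x y z) (cong₂ _+ₚ_ (*ₚ-comm x y) (*ₚ-comm x z)))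

  infixl 6 _⊕_
  _⊕_ : ∀ {n} → Vec Fp n → Vec Fp n → Vec Fp n
  _⊕_ = zipWith _+ₚ_

  infixr 7 _·_
  _·_ : ∀ {n} → Fp → Vec Fp n → Vec Fp n
  c · v = map (c *ₚ_) v

  0ᵥ : ∀ {n} → Vec Fp n
  0ᵥ = replicate _ (ι 0)

  ⊕-assoc : ∀ {n} (u v w : Vec Fp n) → (u ⊕ v) ⊕ w ≡ u ⊕ (v ⊕ w)
  ⊕-assoc = zipWith-assoc +ₚ-assoc

  ⊕-comm : ∀ {n} (v w : Vec Fp n) → v ⊕ w ≡ w ⊕ v
  ⊕-comm = zipWith-comm +ₚ-comm

  ⊕-identityˡ : ∀ {n} (v : Vec Fp n) → 0ᵥ ⊕ v ≡ v
  ⊕-identityˡ = zipWith-identityˡ +ₚ-identityˡ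

  ⊕-identityʳ : ∀ {n} (v : Vec Fp n) → v ⊕ 0ᵥ ≡ v
  ⊕-identityʳ = zipWith-identityʳ +ₚ-identityʳ

  ⊕-interchange : ∀ {n} (s t v w : Vec Fp n) → (s ⊕ t) ⊕ (v ⊕ w) ≡ (s ⊕ v) ⊕ (t ⊕ w)
  ⊕-interchange s t v w = begin
    (s ⊕ t) ⊕ (v ⊕ w)  ≡⟨ ⊕-assoc s t (v ⊕ w) ⟩
    s ⊕ (t ⊕ (v ⊕ w))  ≡⟨ cong (s ⊕_) (⊕-assoc t v w) ⟨
    s ⊕ (t ⊕ v ⊕ w)    ≡⟨ cong (λ x → s ⊕ (x ⊕ w)) (⊕-comm t v) ⟩
    s ⊕ (v ⊕ t ⊕ w)    ≡⟨ cong (s ⊕_) (⊕-assoc v t w) ⟩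
    s ⊕ (v ⊕ (t ⊕ w))  ≡⟨ ⊕-assoc s v (t ⊕ w) ⟨
    (s ⊕ v) ⊕ (t ⊕ w)  ∎

  ·-⊕ : ∀ {n} c (v w : Vec Fp n) → c · (v ⊕ w) ≡ c · v ⊕ c · w
  ·-⊕ c []      []      = refl
  ·-⊕ c (x ∷ v) (y ∷ w) = cong₂ _∷_ (*ₚ-distribˡ-+ₚ c x y) (·-⊕ c v w)

  +ₚ-· : ∀ {n} c d (v : Vec Fp n) → (c +ₚ d) · v ≡ c · v ⊕ d · v
  +ₚ-· c d []      = refl
  +ₚ-· c d (x ∷ v) = cong₂ _∷_ (*ₚ-distribʳ-+ₚ x c d) (+ₚ-· c d v)

  *ₚ-· : ∀ {n} c d (v : Vec Fp n) → (c *ₚ d) · v ≡ c · d · v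
  *ₚ-· c d []      = refl
  *ₚ-· c d (x ∷ v) = cong₂ _∷_ (*ₚ-assoc c d x) (*ₚ-· c d v)

  ·-comm : ∀ {n} c d (v : Vec Fp n) → c · d · v ≡ d · c · v
  ·-comm c d v = trans (sym (*ₚ-· c d v)) (trans (cong (_· v) (*ₚ-comm c d)) (*ₚ-· d c v))

  1· : ∀ {n} (v : Vec Fp n) → ι 1 · v ≡ v
  1· []      = refl
  1· (x ∷ v) = cong₂ _∷_ (*ₚ-identityˡ x) (1· v)

  0· : ∀ {n} (v : Vec Fp n) → ι 0 · v ≡ 0ᵥ
  0· []      = refl
  0· (x ∷ v) = cong₂ _∷_ (*ₚ-zeroˡ x) (0· v)

  ·-0ᵥ : ∀ {n} c → c · 0ᵥ {n} ≡ 0ᵥ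
  ·-0ᵥ {zero}  c = refl
  ·-0ᵥ {suc n} c = cong₂ _∷_ (*ₚ-zeroʳ c) (·-0ᵥ c)

  tabulate-0 : ∀ n → tabulate {n = n} (λ _ → ι 0) ≡ 0ᵥ
  tabulate-0 zero    = refl
  tabulate-0 (suc n) = cong (ι 0 ∷_) (tabulate-0 n)

  constF≡ : ∀ c → constF c ≡ c ∷ 0ᵥ
  constF≡ c = cong (c ∷_) (tabulate-0 (suc r))

  redF≡ : redF ≡ ι 1 ∷ ι 1 ∷ 0ᵥ
  redF≡ = cong (λ v → ι 1 ∷ ι 1 ∷ v) (tabulate-0 r)

  init-⊕ : ∀ {n} (v w : Vec Fp (suc n)) → init (v ⊕ w) ≡ init v ⊕ init w
  init-⊕ {zero}  (x ∷ []) (y ∷ []) = refl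
  init-⊕ {suc n} (x ∷ v)  (y ∷ w)  = cong ((x +ₚ y) ∷_) (init-⊕ v w)

  last-⊕ : ∀ {n} (v w : Vec Fp (suc n)) → last (v ⊕ w) ≡ last v +ₚ last w
  last-⊕ {zero}  (x ∷ []) (y ∷ []) = refl
  last-⊕ {suc n} (x ∷ v)  (y ∷ w)  = last-⊕ v w

  init-· : ∀ {n} c (v : Vec Fp (suc n)) → init (c · v) ≡ c · init v
  init-· {zero}  c (x ∷ []) = refl
  init-· {suc n} c (x ∷ v)  = cong ((c *ₚ x) ∷_) (init-· c v)

  last-· : ∀ {n} c (v : Vec Fp (suc n)) → last (c · v) ≡ c *ₚ last v
  last-· {zero}  c (x ∷ []) = refl
  last-· {suc n} c (x ∷ v)  = last-· c v

  mulX≡ : ∀ v → mulX v ≡ (ι 0 ∷ init v) ⊕ last v · redF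
  mulX≡ (x ∷ v) = refl

  mulX-⊕ : ∀ v w → mulX (v ⊕ w) ≡ mulX v ⊕ mulX w
  mulX-⊕ v w = begin
    mulX (v ⊕ w)
      ≡⟨ mulX≡ (v ⊕ w) ⟩
    (ι 0 ∷ init (v ⊕ w)) ⊕ last (v ⊕ w) · redF
      ≡⟨ cong₂ _⊕_ (cong₂ _∷_ (sym (+ₚ-identityˡ (ι 0))) (init-⊕ v w))
           (trans (cong (_· redF) (last-⊕ v w)) (+ₚ-· (last v) (last w) redF)) ⟩
    ((ι 0 ∷ init v) ⊕ (ι 0 ∷ init w)) ⊕ (last v · redF ⊕ last w · redF)
      ≡⟨ ⊕-interchange (ι 0 ∷ init v) (ι 0 ∷ init w) (last v · redF) (last w · redF) ⟩
    ((ι 0 ∷ init v) ⊕ last v · redF) ⊕ ((ι 0 ∷ init w) ⊕ last w · redF)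
      ≡⟨ cong₂ _⊕_ (mulX≡ v) (mulX≡ w) ⟨
    mulX v ⊕ mulX w ∎

  mulX-· : ∀ c v → mulX (c · v) ≡ c · mulX v
  mulX-· c v = begin
    mulX (c · v)                                  ≡⟨ mulX≡ (c · v) ⟩
    (ι 0 ∷ init (c · v)) ⊕ last (c · v) · redF
      ≡⟨ cong₂ _⊕_ (cong₂ _∷_ (sym (*ₚ-zeroʳ c)) (init-· c v)) (trans (cong (_· redF) (last-· c v)) (*ₚ-· c (last v) redF)) ⟩
    c · (ι 0 ∷ init v) ⊕ c · last v · redF        ≡⟨ ·-⊕ c (ι 0 ∷ init v) (last v · redF) ⟨
    c · ((ι 0 ∷ init v) ⊕ last v · redF)          ≡⟨ cong (c ·_) (mulX≡ v) ⟨
    c · mulX v                                    ∎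

  record IsLinear (L : F → F) : Set where
    field
      homo-⊕ : ∀ v w → L (v ⊕ w) ≡ L v ⊕ L w
      homo-· : ∀ c v → L (c · v) ≡ c · L v

    homo-0 : L 0ᵥ ≡ 0ᵥ
    homo-0 = trans (cong L (sym (0· 0ᵥ))) (trans (homo-· (ι 0) 0ᵥ) (0· (L 0ᵥ)))

  mulX-linear : IsLinear mulX
  mulX-linear = record { homo-⊕ = mulX-⊕ ; homo-· = mulX-· }

  -- horner a v is v(X) applied to a, where X = mulX, so that mulF a b is b(X) a; the ring
  -- laws then hold because polynomials in X commute and X^p = 1 + X as operators.
  horner : ∀ {n} → F → Vec Fp n → F
  horner a v = foldr (λ c acc → addF (scalF c a) (mulX acc)) zeroF (toList v)

  -- A linear operator that commutes with X commutes with every polynomial in X. Powers of X and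
  -- multiplications on either side are the operators it is applied to.
  horner-homo : ∀ {L} → IsLinear L → (∀ v → L (mulX v) ≡ mulX (L v)) →
                ∀ a {n} (v : Vec Fp n) → L (horner a v) ≡ horner (L a) v
  horner-homo {L} linear commutes a []      = IsLinear.homo-0 linear
  horner-homo {L} linear commutes a (c ∷ v) = begin
    L (c · a ⊕ mulX (horner a v))      ≡⟨ homo-⊕ _ _ ⟩
    L (c · a) ⊕ L (mulX (horner a v))
      ≡⟨ cong₂ _⊕_ (homo-· c a) (trans (commutes _) (cong mulX (horner-homo linear commutes a v))) ⟩
    c · L a ⊕ mulX (horner (L a) v)    ∎
    where open IsLinear linear

  horner-⊕ : ∀ a {n} (v w : Vec Fp n) → horner a (v ⊕ w) ≡ horner a v ⊕ horner a w
  horner-⊕ a []      []      = sym (⊕-identityˡ 0ᵥ)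
  horner-⊕ a (x ∷ v) (y ∷ w) = begin
    (x +ₚ y) · a ⊕ mulX (horner a (v ⊕ w))
      ≡⟨ cong₂ _⊕_ (+ₚ-· x y a) (trans (cong mulX (horner-⊕ a v w)) (mulX-⊕ _ _)) ⟩
    (x · a ⊕ y · a) ⊕ (mulX (horner a v) ⊕ mulX (horner a w))
      ≡⟨ ⊕-interchange (x · a) (y · a) _ _ ⟩
    horner a (x ∷ v) ⊕ horner a (y ∷ w) ∎

  horner-· : ∀ a c {n} (v : Vec Fp n) → horner a (c · v) ≡ c · horner a v
  horner-· a c []      = sym (·-0ᵥ c)
  horner-· a c (x ∷ v) = begin
    (c *ₚ x) · a ⊕ mulX (horner a (c · v))
      ≡⟨ cong₂ _⊕_ (*ₚ-· c x a) (trans (cong mulX (horner-· a c v)) (mulX-· c _)) ⟩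
    c · x · a ⊕ c · mulX (horner a v)
      ≡⟨ ·-⊕ c (x · a) _ ⟨
    c · horner a (x ∷ v) ∎

  horner-0ᵥ : ∀ a n → horner a (0ᵥ {n}) ≡ 0ᵥ
  horner-0ᵥ a n = trans (cong (horner a) (sym (0· (0ᵥ {n})))) (trans (horner-· a (ι 0) (0ᵥ {n})) (0· _))

  hornerˡ-linear : ∀ {n} (v : Vec Fp n) → IsLinear (λ a → horner a v)
  hornerˡ-linear v = record { homo-⊕ = ⊕-homo v ; homo-· = ·-homo v }
    where
    ⊕-homo : ∀ {n} (v : Vec Fp n) a b → horner (a ⊕ b) v ≡ horner a v ⊕ horner b v
    ⊕-homo []      a b = sym (⊕-identityˡ 0ᵥ)
    ⊕-homo (c ∷ v) a b = trans
      (cong₂ _⊕_ (·-⊕ c a b) (trans (cong mulX (⊕-homo v a b)) (mulX-⊕ _ _)))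
      (⊕-interchange (c · a) (c · b) _ _)
    ·-homo : ∀ {n} (v : Vec Fp n) d a → horner (d · a) v ≡ d · horner a v
    ·-homo []      d a = sym (·-0ᵥ d)
    ·-homo (c ∷ v) d a = trans
      (cong₂ _⊕_ (·-comm c d a) (trans (cong mulX (·-homo v d a)) (mulX-· d _)))
      (sym (·-⊕ d (c · a) _))

  X^ : ℕ → F → F
  X^ zero    a = a
  X^ (suc n) a = mulX (X^ n a)

  X^-linear : ∀ n → IsLinear (X^ n)
  X^-linear zero    = record { homo-⊕ = λ _ _ → refl ; homo-· = λ _ _ → refl }
  X^-linear (suc n) = record
    { homo-⊕ = λ v w → trans (cong mulX (homo-⊕ v w)) (mulX-⊕ _ _)
    ; homo-· = λ c v → trans (cong mulX (homo-· c v)) (mulX-· c _)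
    }
    where open IsLinear (X^-linear n)

  X^-mulX : ∀ n a → X^ n (mulX a) ≡ mulX (X^ n a)
  X^-mulX zero    a = refl
  X^-mulX (suc n) a = cong mulX (X^-mulX n a)

  -- `horner` recurses from the constant coefficient while `mulX` reduces at the leading one;
  -- splitting at the leading coefficient connects them.
  horner-init-last : ∀ a {n} (v : Vec Fp (suc n)) → horner a v ≡ horner a (init v) ⊕ last v · X^ n a
  horner-init-last a {zero}  (c ∷ [])    = trans
    (cong (c · a ⊕_) (IsLinear.homo-0 mulX-linear)) (⊕-comm (c · a) 0ᵥ)
  horner-init-last a {suc n} (c ∷ v) = begin
    c · a ⊕ mulX (horner a v)
      ≡⟨ cong (λ x → c · a ⊕ mulX x) (horner-init-last a v) ⟩
    c · a ⊕ mulX (horner a (init v) ⊕ last v · X^ n a)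
      ≡⟨ cong (c · a ⊕_) (trans (mulX-⊕ _ _) (cong (mulX (horner a (init v)) ⊕_) (mulX-· (last v) _))) ⟩
    c · a ⊕ (mulX (horner a (init v)) ⊕ last v · X^ (suc n) a)
      ≡⟨ ⊕-assoc (c · a) _ _ ⟨
    horner a (c ∷ init v) ⊕ last v · X^ (suc n) a ∎

  -- Extension by zeros allows the induction behind `horner-one` to pass through vectors shorter
  -- than p.
  pad : ∀ {k} n → Vec Fp k → Vec Fp n
  pad zero    v       = []
  pad (suc n) []      = ι 0 ∷ pad n []
  pad (suc n) (c ∷ v) = c ∷ pad n v

  pad-[] : ∀ n → pad n [] ≡ 0ᵥ
  pad-[] zero    = refl
  pad-[] (suc n) = cong (ι 0 ∷_) (pad-[] n)

  pad-id : ∀ {n} (v : Vec Fp n) → pad n v ≡ v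
  pad-id []      = refl
  pad-id (c ∷ v) = cong (c ∷_) (pad-id v)

  init-pad : ∀ {k} n (v : Vec Fp k) → init (pad (suc n) v) ≡ pad n v
  init-pad zero    []      = refl
  init-pad zero    (c ∷ v) = refl
  init-pad (suc n) []      = cong (ι 0 ∷_) (init-pad n [])
  init-pad (suc n) (c ∷ v) = cong (c ∷_) (init-pad n v)

  last-pad : ∀ {k} n (v : Vec Fp k) → k ≤ n → last (pad (suc n) v) ≡ ι 0
  last-pad zero    []      _         = refl
  last-pad (suc n) []      _         = last-pad n [] z≤n
  last-pad (suc n) (c ∷ v) (s≤s k≤n) = last-pad n v k≤n

  -- Each multiplication by x meets a top coefficient 0, so it is a pure shift, and no reduction
  -- takes place below degree p.
  horner-one-pad : ∀ {k} (v : Vec Fp k) → k ≤ p → horner oneF v ≡ pad p v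
  horner-one-pad []      _         = sym (pad-[] p)
  horner-one-pad (c ∷ v) (s≤s k≤n) = begin
    c · oneF ⊕ mulX (horner oneF v)
      ≡⟨ cong₂ _⊕_ (trans (cong (c ·_) (constF≡ (ι 1))) (cong₂ _∷_ (*ₚ-identityʳ c) (·-0ᵥ c)))
                   (cong mulX (horner-one-pad v (ℕ.m≤n⇒m≤1+n k≤n))) ⟩
    (c ∷ 0ᵥ) ⊕ mulX (pad p v)
      ≡⟨ cong ((c ∷ 0ᵥ) ⊕_) (begin
           mulX (pad p v)
             ≡⟨ mulX≡ (pad p v) ⟩
           (ι 0 ∷ init (pad p v)) ⊕ last (pad p v) · redF
             ≡⟨ cong₂ (λ w l → (ι 0 ∷ w) ⊕ l · redF) (init-pad (suc r) v) (last-pad (suc r) v k≤n) ⟩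
           (ι 0 ∷ pad (suc r) v) ⊕ ι 0 · redF
             ≡⟨ trans (cong ((ι 0 ∷ pad (suc r) v) ⊕_) (0· redF)) (⊕-identityʳ _) ⟩
           ι 0 ∷ pad (suc r) v ∎) ⟩
    (c ∷ 0ᵥ) ⊕ (ι 0 ∷ pad (suc r) v)
      ≡⟨ cong₂ _∷_ (+ₚ-identityʳ c) (⊕-identityˡ (pad (suc r) v)) ⟩
    c ∷ pad (suc r) v ∎

  horner-one : ∀ v → horner oneF v ≡ v
  horner-one v = trans (horner-one-pad v ℕ.≤-refl) (pad-id v)

  horner-red : ∀ a → horner a redF ≡ a ⊕ mulX a
  horner-red a = begin
    horner a redF
      ≡⟨ cong (horner a) redF≡ ⟩
    ι 1 · a ⊕ mulX (ι 1 · a ⊕ mulX (horner a (0ᵥ {r})))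
      ≡⟨ cong₂ (λ x y → x ⊕ mulX (x ⊕ mulX y)) (1· a) (horner-0ᵥ a r) ⟩
    a ⊕ mulX (a ⊕ mulX 0ᵥ)
      ≡⟨ cong (λ x → a ⊕ mulX x) (trans (cong (a ⊕_) (IsLinear.homo-0 mulX-linear)) (⊕-identityʳ a)) ⟩
    a ⊕ mulX a ∎

  -- x^(p-1) is the last basis vector, so the next multiplication by x is the first to trigger the
  -- reduction, which returns `redF`.
  X^p-one : X^ p oneF ≡ oneF ⊕ mulX oneF
  X^p-one = begin
    mulX (X^ (suc r) oneF)                         ≡⟨ cong mulX X^[p-1] ⟩
    mulX v                                         ≡⟨ mulX≡ v ⟩
    (ι 0 ∷ init v) ⊕ last v · redF
      ≡⟨ cong₂ (λ w l → (ι 0 ∷ w) ⊕ l · redF) (init-∷ʳ (ι 1) (0ᵥ {suc r})) (last-∷ʳ (ι 1) (0ᵥ {suc r})) ⟩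
    0ᵥ ⊕ ι 1 · redF                                ≡⟨ trans (⊕-identityˡ _) (1· redF) ⟩
    redF                                           ≡⟨ horner-one redF ⟨
    horner oneF redF                               ≡⟨ horner-red oneF ⟩
    oneF ⊕ mulX oneF                               ∎
    where
    v : F
    v = 0ᵥ ∷ʳ ι 1
    X^[p-1] : X^ (suc r) oneF ≡ v
    X^[p-1] = sym (begin
      v                                                  ≡⟨ horner-one v ⟨
      horner oneF v                                      ≡⟨ horner-init-last oneF v ⟩
      horner oneF (init v) ⊕ last v · X^ (suc r) oneF
        ≡⟨ cong₂ (λ w l → horner oneF w ⊕ l · X^ (suc r) oneF) (init-∷ʳ (ι 1) (0ᵥ {suc r})) (last-∷ʳ (ι 1) (0ᵥ {suc r})) ⟩
      horner oneF (0ᵥ {suc r}) ⊕ ι 1 · X^ (suc r) oneF   ≡⟨ cong₂ _⊕_ (horner-0ᵥ oneF (suc r)) (1· _) ⟩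
      0ᵥ ⊕ X^ (suc r) oneF                               ≡⟨ ⊕-identityˡ _ ⟩
      X^ (suc r) oneF                                    ∎)

  -- Every a is a polynomial in X applied to 1, so a relation between powers of X that holds at 1
  -- holds everywhere.
  X^p : ∀ a → X^ p a ≡ a ⊕ mulX a
  X^p a = begin
    X^ p a                           ≡⟨ cong (X^ p) (horner-one a) ⟨
    X^ p (horner oneF a)             ≡⟨ horner-homo (X^-linear p) (X^-mulX p) oneF a ⟩
    horner (X^ p oneF) a             ≡⟨ cong (λ x → horner x a) X^p-one ⟩
    horner (oneF ⊕ mulX oneF) a      ≡⟨ IsLinear.homo-⊕ (hornerˡ-linear a) oneF (mulX oneF) ⟩
    horner oneF a ⊕ horner (mulX oneF) a  ≡⟨ cong (horner oneF a ⊕_) (horner-homo mulX-linear (λ _ → refl) oneF a) ⟨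
    horner oneF a ⊕ mulX (horner oneF a)  ≡⟨ cong (λ x → x ⊕ mulX x) (horner-one a) ⟩
    a ⊕ mulX a                       ∎

  mulF-mulXˡ : ∀ a b → mulX (mulF a b) ≡ mulF (mulX a) b
  mulF-mulXˡ a b = horner-homo mulX-linear (λ _ → refl) a b

  -- `mulX` shifts the coefficients of b and folds the top one into `redF`; when b is evaluated at
  -- the operator X, the relation X^p = 1 + X justifies this fold.
  mulF-mulXʳ : ∀ a b → mulF a (mulX b) ≡ mulX (mulF a b)
  mulF-mulXʳ a b = begin
    horner a (mulX b)
      ≡⟨ cong (horner a) (mulX≡ b) ⟩
    horner a ((ι 0 ∷ init b) ⊕ last b · redF)
      ≡⟨ horner-⊕ a (ι 0 ∷ init b) (last b · redF) ⟩
    (ι 0 · a ⊕ mulX (horner a (init b))) ⊕ horner a (last b · redF)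
      ≡⟨ cong₂ _⊕_ (trans (cong (_⊕ mulX (horner a (init b))) (0· a)) (⊕-identityˡ _))
                   (trans (horner-· a (last b) redF) (cong (last b ·_) (trans (horner-red a) (sym (X^p a))))) ⟩
    mulX (horner a (init b)) ⊕ last b · mulX (X^ (suc r) a)
      ≡⟨ cong (mulX (horner a (init b)) ⊕_) (mulX-· (last b) _) ⟨
    mulX (horner a (init b)) ⊕ mulX (last b · X^ (suc r) a)
      ≡⟨ mulX-⊕ _ _ ⟨
    mulX (horner a (init b) ⊕ last b · X^ (suc r) a)
      ≡⟨ cong mulX (horner-init-last a b) ⟨
    mulX (horner a b) ∎

  -- Both sides are a(X) b(X) applied to 1, and polynomials in X commute.
  mulF-comm : ∀ a b → mulF a b ≡ mulF b a
  mulF-comm a b = begin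
    horner a b                 ≡⟨ cong (λ x → horner x b) (horner-one a) ⟨
    horner (horner oneF a) b   ≡⟨ horner-homo (hornerˡ-linear b) (λ x → sym (mulF-mulXˡ x b)) oneF a ⟩
    horner (horner oneF b) a   ≡⟨ cong (λ x → horner x a) (horner-one b) ⟩
    horner b a                 ∎

  mulF-assoc : ∀ a b c → mulF (mulF a b) c ≡ mulF a (mulF b c)
  mulF-assoc a b c = sym (horner-homo (record { homo-⊕ = λ v w → horner-⊕ a v w ; homo-· = λ c v → horner-· a c v }) (mulF-mulXʳ a) b c)

  mulF-identityˡ : ∀ a → mulF oneF a ≡ a
  mulF-identityˡ = horner-one

  mulF-distribˡ : ∀ a b c → mulF a (b ⊕ c) ≡ mulF a b ⊕ mulF a c
  mulF-distribˡ a b c = horner-⊕ a b c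

  F-isCommutativeRing : IsCommutativeRing _≡_ addF mulF negF zeroF oneF
  F-isCommutativeRing = record
    { isRing = record
      { +-isAbelianGroup = record
        { isGroup = record
          { isMonoid = record
            { isSemigroup = record
              { isMagma = isMagma addF
              ; assoc = ⊕-assoc
              }
            ; identity = ⊕-identityˡ , ⊕-identityʳ
            }
          ; inverse = zipWith-inverseˡ +ₚ-inverseˡ , zipWith-inverseʳ +ₚ-inverseʳ
          ; ⁻¹-cong = cong negF
          }
        ; comm = ⊕-comm
        }
      ; *-cong = cong₂ mulF
      ; *-assoc = mulF-assoc
      ; *-identity = mulF-identityˡ , λ a → trans (mulF-comm a oneF) (mulF-identityˡ a)
      ; distrib = mulF-distribˡ , λ a b c → IsLinear.homo-⊕ (hornerˡ-linear a) b c
      }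
    ; *-comm = mulF-comm
    }

-- Transfer to the concrete definitions and assembly of the coefficient formula.

module BellPolynomial (r : ℕ) where
  open QuotientRing r
  open PropositionalRing F-isCommutativeRing
  open Field p using (F; ι; constF; oneF; mulX; mulF; negF; powF; sumF; powPoly; linPoly)
    renaming (Tr to TrF)

  constF-ι : ∀ n → constF (ι n) ≡ ν n
  constF-ι zero    = constF≡ (ι 0)
  constF-ι (suc n) = begin
    constF (ι (suc n))          ≡⟨ constF≡ (ι (suc n)) ⟩
    ι (suc n) ∷ 0ᵥ              ≡⟨ cong₂ _∷_ (ι-homo-+ 1 n) (sym (⊕-identityˡ 0ᵥ)) ⟩
    (ι 1 ∷ 0ᵥ) ⊕ (ι n ∷ 0ᵥ)     ≡⟨ cong₂ _⊕_ (constF≡ (ι 1)) (constF≡ (ι n)) ⟨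
    oneF ⊕ constF (ι n)         ≡⟨ cong (oneF ⊕_) (constF-ι n) ⟩
    ν (suc n)                   ∎

  ν-p : ν p ≡ 0#
  ν-p = trans (sym (constF-ι p)) (trans (cong constF ι-p) (constF≡ (ι 0)))

  powF≡ : ∀ x n → powF x n ≡ x ^ n
  powF≡ x zero    = refl
  powF≡ x (suc n) = cong (x *_) (powF≡ x n)

  sumF≡ : ∀ n f → sumF n f ≡ Σ n f
  sumF≡ zero    f = refl
  sumF≡ (suc n) f = cong (_+ f n) (sumF≡ n f)

  powPoly-linPoly : ∀ a θ m k → powPoly (linPoly a θ) m k ≡ ν (m C k) * ν a ^ k * θ ^ (m ∸ k)
  powPoly-linPoly a θ zero zero = sym (trans (*-identityʳ (ν 1 * 1#)) (trans (*-identityʳ (ν 1)) ν-1))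
  powPoly-linPoly a θ zero (suc k) = sym (begin
    ν (0 C suc k) * ν a ^ suc k * 1#   ≡⟨ cong (λ c → ν c * ν a ^ suc k * 1#) (k>n⇒nCk≡0 {0} {suc k} (s≤s z≤n)) ⟩
    0# * ν a ^ suc k * 1#              ≡⟨ trans (*-identityʳ (0# * ν a ^ suc k)) (zeroˡ (ν a ^ suc k)) ⟩
    0#                                 ∎)
  powPoly-linPoly a θ (suc m) zero = begin
    0# + θ * powPoly (linPoly a θ) m 0    ≡⟨ +-identityˡ (θ * powPoly (linPoly a θ) m 0) ⟩
    θ * powPoly (linPoly a θ) m 0         ≡⟨ cong (θ *_) (powPoly-linPoly a θ m 0) ⟩
    θ * (ν (m C 0) * 1# * θ ^ m)
      ≡⟨ solve 3 (λ θ c t → θ :* (c :* con 1 :* t) := c :* con 1 :* (θ :* t)) refl θ (ν (m C 0)) (θ ^ m) ⟩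
    ν (m C 0) * 1# * θ ^ suc m            ∎
  powPoly-linPoly a θ (suc m) (suc k) = begin
    sumF (suc (suc k)) f
      ≡⟨ trans (sumF≡ (suc (suc k)) f) (Σ-pair (suc (suc k)) f {0} {1} (s≤s z≤n) (s≤s (s≤s z≤n)) off) ⟩
    θ * powPoly (linPoly a θ) m (suc k) + constF (ι a) * powPoly (linPoly a θ) m k
      ≡⟨ cong₂ _+_ (cong (θ *_) (powPoly-linPoly a θ m (suc k))) (cong₂ _*_ (constF-ι a) (powPoly-linPoly a θ m k)) ⟩
    θ * (ν (m C suc k) * ν a ^ suc k * θ ^ (m ∸ suc k)) + ν a * (ν (m C k) * ν a ^ k * θ ^ (m ∸ k))
      ≡⟨ ν-C-pascal θ (ν a) m k ⟩
    ν (suc m C suc k) * ν a ^ suc k * θ ^ (m ∸ k) ∎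
    where
    f : ℕ → F
    f i = mulF (linPoly a θ i) (powPoly (linPoly a θ) m (suc k ∸ i))
    off : ∀ i → i < suc (suc k) → i ≢ 0 → i ≢ 1 → f i ≡ 0#
    off zero          _ 0≢0 _   = ⊥-elim (0≢0 refl)
    off (suc zero)    _ _   1≢1 = ⊥-elim (1≢1 refl)
    off (suc (suc i)) _ _   _   = zeroˡ (powPoly (linPoly a θ) m (suc k ∸ suc (suc i)))

  module _ (pp : Prime p) where
    open PrimeCharacteristic pp ν-p

    TrF≡ : ∀ y → TrF y ≡ Tr y
    TrF≡ y = trans (sumF≡ p _) (Σ-cong p λ i _ → powF≡ y (p ℕ.^ i))

    x : F
    x = mulX oneF

    mulX≡x* : ∀ v → mulX v ≡ x * v
    mulX≡x* v = trans (cong mulX (sym (*-identityˡ v))) (mulF-mulXˡ oneF v)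

    x^n≡ : ∀ n → x ^ n ≡ X^ n oneF
    x^n≡ zero    = refl
    x^n≡ (suc n) = trans (sym (mulX≡x* (x ^ n))) (cong mulX (x^n≡ n))

    x^p : x ^ p ≡ x + 1#
    x^p = trans (x^n≡ p) (trans X^p-one (⊕-comm oneF x))

    frob-p-x : frob p x ≡ x
    frob-p-x = trans (frob-translate x^p p) (trans (cong (x +_) ν-p) (+-identityʳ x))

    -- The p-th iterate of Frobenius is a ring map that fixes 𝔽_p and, by x ↦ x + p = x, the
    -- generator x, hence every polynomial in x.
    frob-p : ∀ y → frob p y ≡ y
    frob-p y = trans (cong (frob p) (sym (horner-one y))) (trans (go y) (horner-one y))
      where
      scalar : ∀ c → c · oneF ≡ ν (toℕ c)
      scalar c = begin
        c · oneF               ≡⟨ cong (c ·_) (constF≡ (ι 1)) ⟩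
        (c *ₚ ι 1) ∷ c · 0ᵥ    ≡⟨ cong₂ _∷_ (*ₚ-identityʳ c) (·-0ᵥ c) ⟩
        c ∷ 0ᵥ                 ≡⟨ cong (_∷ 0ᵥ) (ι-toℕ c) ⟨
        ι (toℕ c) ∷ 0ᵥ         ≡⟨ constF≡ (ι (toℕ c)) ⟨
        constF (ι (toℕ c))     ≡⟨ constF-ι (toℕ c) ⟩
        ν (toℕ c)              ∎
        where open Field p using (_*ₚ_)
      go : ∀ {n} (v : Vec (Fin p) n) → frob p (horner oneF v) ≡ horner oneF v
      go []      = frob-fixed (0^ p) p
      go (c ∷ v) = begin
        frob p (c · oneF + mulX h)
          ≡⟨ cong (frob p) (cong₂ _+_ (scalar c) (mulX≡x* h)) ⟩
        frob p (ν (toℕ c) + x * h)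
          ≡⟨ trans (frob-+ p _ _) (cong (frob p (ν (toℕ c)) +_) (frob-* p x h)) ⟩
        frob p (ν (toℕ c)) + frob p x * frob p h
          ≡⟨ cong₂ _+_ (frob-fixed (frobenius-ν (toℕ c)) p) (cong₂ _*_ frob-p-x (go v)) ⟩
        ν (toℕ c) + x * h
          ≡⟨ cong₂ _+_ (scalar c) (mulX≡x* h) ⟨
        c · oneF + mulX h ∎
        where h = horner oneF v

    open FiniteField frob-p

    bell-trace-formula : ∀ a m b → (a ℕ.* b) % p ≡ 1 →
      ∀ θ → powF θ p ≡ θ + 1# → ∀ u → u * powF θ (suc (τ p a)) ≡ 1# → ∀ k →
      constF (ι (a ℕ.^ m ℕ.* bell m b k))
      ≡ - TrF (powF θ (τ p a)) * TrF (powPoly (linPoly a θ) m k * u)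
    bell-trace-formula a m b ab≡1 θ θᵖ u uθt≡1 k = sym (begin
      - TrF (powF θ (τ p a)) * TrF (powPoly (linPoly a θ) m k * u)
        ≡⟨ cong₂ (λ s t → - s * t) (trans (TrF≡ _) (cong Tr (powF≡ θ (τ p a)))) (TrF≡ _) ⟩
      - T * Tr (powPoly (linPoly a θ) m k * u)
        ≡⟨ *-congˡ (cong Tr (trans (cong (_* u) (powPoly-linPoly a θ m k)) (*-assoc c (θ ^ (m ∸ k)) u))) ⟩
      - T * Tr (c * (θ ^ (m ∸ k) * u))
        ≡⟨ *-congˡ (Tr-* cᵖ _) ⟩
      - T * (c * Tr (θ ^ (m ∸ k) * u))
        ≡⟨ solve 3 (λ x c y → x :* (c :* y) := c :* (x :* y)) refl (- T) c (Tr (θ ^ (m ∸ k) * u)) ⟩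
      c * (- T * Tr (θ ^ (m ∸ k) * u))
        -- The range `suc m` is taken to match the sum in `ν-bell`; it is large enough since m - k ≤
        -- m.
        ≡⟨ *-congˡ (AS.trace-formula (trans (*-congˡ (sym (powF≡ θ (suc (τ p a))))) uθt≡1) (m ∸ k) (suc m) (s≤s (ℕ.m∸n≤m m k))) ⟩
      c * Σ (suc m) (λ j → ν (S (m ∸ k) j) * (ν a ^ (m ∸ k) * ν b ^ j))
        ≡⟨ ν-bell a m b k ⟨
      ν (a ℕ.^ m ℕ.* bell m b k)
        ≡⟨ constF-ι (a ℕ.^ m ℕ.* bell m b k) ⟨
      constF (ι (a ℕ.^ m ℕ.* bell m b k)) ∎)
      where
      module AS = ArtinSchreier {θ} (trans (sym (powF≡ θ p)) θᵖ) {a} {b} ab≡1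
      T c : F
      T = Tr (θ ^ τ p a)
      c = ν (m C k) * ν a ^ k
      -- The factor c is the image of a natural number, hence fixed by Frobenius, which lets it
      -- leave the trace.
      cᵖ : c ^ p ≡ c
      cᵖ = trans (cong (_^ p) (sym c≡ν)) (trans (frobenius-ν ((m C k) ℕ.* a ℕ.^ k)) c≡ν)
        where
        c≡ν : ν ((m C k) ℕ.* a ℕ.^ k) ≡ c
        c≡ν = trans (ν-* (m C k) (a ℕ.^ k)) (*-congˡ (ν-^ a k))

open import Data.Nat.Base using (_+_; _*_; _^_)
open Field

theorem3p1 : (p : ℕ) .{{_ : NonZero p}} → Prime p →
    (a m : ℕ) → gcd a p ≡ 1 →
    (ainv : ℕ) → (a * ainv) % p ≡ 1 →
    (θ : F p) → powF p θ p ≡ addF p θ (oneF p) →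
    (θinv : F p) → mulF p θinv (powF p θ (1 + τ p a)) ≡ oneF p →
    (k : ℕ) →
    constF p (ι p (a ^ m * bell m ainv k))
    ≡ mulF p (negF p (Tr p (powF p θ (τ p a))))
    (Tr p (mulF p (powPoly p (linPoly p a θ) m k) θinv))
theorem3p1 zero          pp = ⊥-elim (¬prime[0] pp)
theorem3p1 (suc zero)    pp = ⊥-elim (¬prime[1] pp)
theorem3p1 (suc (suc r)) pp a m _ ainv ab≡1 θ θᵖ θinv =
  BellPolynomial.bell-trace-formula r pp a m ainv ab≡1 θ θᵖ θinv
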